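{- Let $q=p^t$ with $p$ prime and $t\ge 1$, let $V$ be a $4$-dimensional vector space over $\mathbb{F}_q$, and let $A$ be the $0/1$ matrix, viewed as an integer matrix, whose rows and columns are both indexed by the $2$-dimensional subspaces of $V$ (in a fixed order), with $(U,W)$-entry equal to $1$ if and only if $U\cap W=\{0\}$. For $i\ge 0$ let $e_i=e_i(A)$ denote the multiplicity of $p^i$ as an elementary divisor of $A$ (i.e. in the Smith normal form of $A$ over $\mathbb{Z}$). Then: (1) $e_i=e_{3t-i}$ for $0\le i<t$; (2) $e_i=0$ for $t<i<2t$, for $3t<i<4t$, and for $i>4t$; (3) $\sum_{i=0}^{t}e_i=q^4+q^2$; (4) $\sum_{i=2t}^{3t}e_i=q^3+q^2+q$; (5) $e_{4t}=1$.
   Context: All elementary divisors of $A$ are powers of $p$ (so the numbers $e_i$ describe the full Smith normal form of $A$). -}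

module Defs where

open import Level using (Level; _⊔_) renaming (suc to lsuc)
open import Algebra.Apartness.Bundles using (HeytingField; HeytingCommutativeRing)
open import Algebra.Bundles using (CommutativeRing)
open import Algebra.Module.Bundles using (Module)
import Algebra.Properties.CommutativeMonoid.Sum as CommutativeMonoidSum
open import Data.Bool.Base using (if_then_else_)
open import Data.Fin.Base as Fin using (Fin; toℕ)
import Data.Fin.Properties as Fin
open import Data.Integer.Base as ℤ using (ℤ; +_; 0ℤ; 1ℤ)
import Data.Integer.Properties as ℤ
open import Data.Nat.Base as ℕ using (ℕ; suc; _∸_; _^_)
open import Data.Nat.Divisibility using (_∣_)
import Data.Nat.Properties as ℕ
open import Data.Product.Base using (Σ-syntax; ∃-syntax; _×_; proj₁)
open import Data.Sum.Base using (_⊎_)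
open import Data.Vec.Base using (count; tabulate)
open import Data.Vec.Functional using (Vector)
open import Function.Bundles using (Inverse; _⇔_)
import Relation.Binary.Construct.On as On
open import Relation.Binary.Bundles using (Setoid)
open import Relation.Binary.PropositionalEquality using (_≡_; setoid)
open import Relation.Nullary.Decidable using (does)
open import Relation.Unary using (Pred; _∈_; _∩_; _≐_)
open import Relation.Unary.Relation.Binary.Equality using (≐-setoid)

private
  variable
    n : ℕ

module ∑ℕ = CommutativeMonoidSum ℕ.+-0-commutativeMonoid
module ∑ℤ = CommutativeMonoidSum ℤ.+-0-commutativeMonoid

∑[_⋯_]_ : ℕ → ℕ → (ℕ → ℕ) → ℕ
∑[ a ⋯ b ] f = ∑ℕ.sum {n = suc b ∸ a} (λ k → f (a ℕ.+ toℕ k))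

infix 6 ∑[_⋯_]_

Matrix : ℕ → Set
Matrix n = Fin n → Fin n → ℤ

infix 4 _≈ₘ_
_≈ₘ_ : Matrix n → Matrix n → Set
M ≈ₘ M′ = ∀ i j → M i j ≡ M′ i j

infixl 7 _*ₘ_
_*ₘ_ : Matrix n → Matrix n → Matrix n
(M *ₘ M′) i j = ∑ℤ.sum (λ k → M i k ℤ.* M′ k j)

diagonal : Vector ℕ n → Matrix n
diagonal d i j = if does (i Fin.≟ j) then + d i else 0ℤ

identity : Matrix n
identity = diagonal (λ _ → 1)

InvertibleMatrix : Matrix n → Set
InvertibleMatrix M = ∃[ M⁻¹ ] (M *ₘ M⁻¹ ≈ₘ identity) × (M⁻¹ *ₘ M ≈ₘ identity)

-- The diagonal entries are natural numbers, so that they are determined by A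
-- and not only up to sign.
record SmithNormalForm (A : Matrix n) : Set where
  field
    P Q          : Matrix n
    P-invertible : InvertibleMatrix P
    Q-invertible : InvertibleMatrix Q
    d            : Vector ℕ n
    d-divides    : ∀ {i j} → i Fin.≤ j → d i ∣ d j
    PAQ≈diagonal : P *ₘ A *ₘ Q ≈ₘ diagonal d

  multiplicity : ℕ → ℕ
  multiplicity x = count (ℕ._≟ x) (tabulate d)

-- On a finite field equality is decidable, so the tight apartness of a
-- Heyting field is just the negation of equality.
module _ {c ℓ ℓ# : Level} (F : HeytingField c ℓ ℓ#) where

  fieldRing : CommutativeRing c ℓ
  fieldRing =
    HeytingCommutativeRing.commutativeRing (HeytingField.heytingCommutativeRing F)

  HasOrder : ℕ → Set (c ⊔ ℓ)
  HasOrder q = Inverse (setoid (Fin q)) (CommutativeRing.setoid fieldRing)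

  VectorSpace : (m ℓm : Level) → Set (c ⊔ ℓ ⊔ lsuc (m ⊔ ℓm))
  VectorSpace m ℓm = Module fieldRing m ℓm

module _ {c ℓ ℓ# m ℓm : Level} (F : HeytingField c ℓ ℓ#) (V : VectorSpace F m ℓm) where

  open CommutativeRing (fieldRing F) using (Carrier; _≈_; 0#)
  open Module V using (Carrierᴹ; _≈ᴹ_; _+ᴹ_; _*ₗ_; 0ᴹ; +ᴹ-commutativeMonoid)

  linearCombination : Vector Carrier n → Vector Carrierᴹ n → Carrierᴹ
  linearCombination a b =
    CommutativeMonoidSum.sum +ᴹ-commutativeMonoid (λ i → a i *ₗ b i)

  record IsBasis {w : Level} (W : Pred Carrierᴹ w) (b : Vector Carrierᴹ n)
                 : Set (c ⊔ ℓ ⊔ m ⊔ ℓm ⊔ w) where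
    field
      basis∈      : ∀ i → b i ∈ W
      independent : ∀ a → linearCombination a b ≈ᴹ 0ᴹ → ∀ i → a i ≈ 0#
      spanning    : ∀ {x} → x ∈ W → ∃[ a ] x ≈ᴹ linearCombination a b

  HasDimension : {w : Level} → Pred Carrierᴹ w → ℕ → Set (c ⊔ ℓ ⊔ m ⊔ ℓm ⊔ w)
  HasDimension W k = Σ[ b ∈ Vector Carrierᴹ k ] IsBasis W b

  record Subspace (s : Level) : Set (c ⊔ m ⊔ ℓm ⊔ lsuc s) where
    field
      member    : Pred Carrierᴹ s
      resp-≈ᴹ   : ∀ {x y} → x ≈ᴹ y → x ∈ member → y ∈ member
      0ᴹ∈       : 0ᴹ ∈ member
      +ᴹ-closed : ∀ {x y} → x ∈ member → y ∈ member → (x +ᴹ y) ∈ member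
      *ₗ-closed : ∀ a {x} → x ∈ member → (a *ₗ x) ∈ member

  open Subspace

  Grassmannian : (s : Level) → ℕ → Setoid (c ⊔ ℓ ⊔ m ⊔ ℓm ⊔ lsuc s) (m ⊔ s)
  Grassmannian s k =
    On.setoid {B = Σ[ W ∈ Subspace s ] HasDimension (member W) k}
              (≐-setoid Carrierᴹ s) (λ W → member (proj₁ W))

  Ordering : (s : Level) → ℕ → ℕ → Set (c ⊔ ℓ ⊔ m ⊔ ℓm ⊔ lsuc s)
  Ordering s k N = Inverse (setoid (Fin N)) (Grassmannian s k)

  MeetTrivially : {s : Level} → Subspace s → Subspace s → Set (m ⊔ ℓm ⊔ s)
  MeetTrivially W W′ = member W ∩ member W′ ≐ (_≈ᴹ 0ᴹ)

  IsSkewnessMatrix : {s : Level} {k N : ℕ} → Ordering s k N → Matrix N → Set (m ⊔ ℓm ⊔ s)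
  IsSkewnessMatrix order A = ∀ i j →
    (A i j ≡ 0ℤ ⊎ A i j ≡ 1ℤ) ×
    (A i j ≡ 1ℤ ⇔ MeetTrivially (subspace i) (subspace j))
    where
    subspace = λ i → proj₁ (Inverse.to order i)

-- Let M be the incidence matrix of the N lines and the m = q³ + q² + q + 1 points
-- of PG(3,q). Since M Mᵀ = qI + J - A, the matrix A acts as q on ker Mᵀ, of rank
-- N - m = q⁴ + q², so at most m of the exponents a_j of the elementary divisors
-- p^(a_j) exceed t. Since A M = q²(J - M) and M is injective, at least m of them
-- are ≥ 2t; so both bounds are attained and no exponent lies strictly between t and 2t.
-- Moreover A (A + q² - q) = q³ (I + (q - 1) J) with A + q² - q ≡ A modulo q,
-- which matches the exponents a < t with the exponents 3t - a; the remaining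
-- exponent 4t belongs to the all-ones vector, whose eigenvalue is q⁴.

module Submission where

open import Defs
open import Level using (Level; Lift; lift; 0ℓ)
open import Algebra.Apartness.Bundles using (HeytingField)
open import Algebra.Bundles using (CommutativeRing)
open import Algebra.Module.Bundles using (Module)
import Algebra.Module.Properties.LeftModule as LeftModuleProperties
import Algebra.Properties.CommutativeMonoid.Sum as CommutativeMonoidSum
import Algebra.Properties.Ring as RingProperties
import Data.Bool.Base as Bool
open import Data.Fin.Base as Fin
  using (Fin; zero; suc; splitAt; _↑ˡ_; _↑ʳ_; join; finToFun; funToFin; punchOut; combine)
import Data.Fin.Properties as Fin
open import Data.Integer.Base using (ℤ; 0ℤ; 1ℤ)
open import Data.List.Base as List using (List; []; _∷_; _++_; length; map; filter; allFin)
open import Data.List.Membership.Propositional.Properties using (∈-filter⁺; ∈-allFin)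
import Data.List.Properties as List
open import Data.List.Relation.Unary.All as All using (All; []; _∷_)
import Data.List.Relation.Unary.All.Properties as All
open import Data.Nat.Base as ℕ using (ℕ; zero; suc; _^_)
open import Data.Nat.Coprimality using (Coprime; coprime-divisor)
import Data.Nat.Divisibility as ℕ
open import Data.Nat.Primality using (Prime; prime⇒irreducible; prime⇒nonZero)
import Data.Nat.Properties as ℕ
open import Data.Product.Base using (_×_; _,_; proj₁; proj₂; ∃-syntax; Σ-syntax)
open import Data.Sum.Base as Sum using (_⊎_; inj₁; inj₂)
open import Data.Vec.Base as Vec using (count; tabulate)
open import Data.Vec.Functional using (Vector)
open import Function.Base using (_∘_)
open import Function.Bundles using (Inverse; Equivalence)
open import Relation.Binary.Definitions using (tri<; tri≈; tri>)
open import Relation.Binary.PropositionalEquality as ≡ using (_≡_; _≢_; _≗_)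
import Relation.Binary.Reasoning.Setoid as ≈-Reasoning
open import Relation.Nullary using (¬_; Dec; yes; no; contradiction; ¬?; does; _×-dec_)
open import Relation.Nullary.Decidable using (decidable-stable; map′; True; toWitness; fromWitness)
open import Relation.Unary using (Pred; Decidable; _∈_; _∩_; _⊆_; U)
open import Relation.Unary.Properties using (U?)

-- Neither ranks modulo p nor determinants appear. All bounds concern the cumulative count
-- `below a k` of the exponents less than `k`, and each comes from counting over ℤ: a homogeneous
-- system with fewer equations than unknowns has a nonzero integer solution, which becomes primitive
-- after division by a power of p. Too many exponents ≥ k would give a primitive vector in the span
-- of the columns of Q that satisfies prescribed equations and that A annihilates modulo p^k; too
-- few would let a primitive vector annihilated modulo p^k have all its Q⁻¹-coordinates divisible by
-- p. The term (q - 1) J spoils an exact duality between A and A + q² - q. It disappears on vectors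
-- of sum 0; in the opposite bound the all-ones vector enters as one more column, and the
-- independence of this column modulo p rests on N ≡ 1 modulo p. That all elementary divisors are
-- powers of p is proved from the integrality of q⁴ A⁻¹.

-- Integer linear forms and homogeneous systems

module LinearForms where

  open ≡

  open import Data.Integer.Base using (+_; _+_; _*_; -_)
  open import Data.Integer.Divisibility.Signed using (_∣_; divides; ∣m∣n⇒∣m+n; ∣n⇒∣m*n)
  open import Data.Integer.Properties
  open import Data.Integer.Tactic.RingSolver using (solve-∀)
  import Algebra.Properties.Semiring.Sum +-*-semiring as SumProperties
  open ≡-Reasoning

  infix 8 _·_ _∙_

  -- Opaque, so that unification can recover the summand.
  opaque
    ∑ : ∀ {n} → (Fin n → ℤ) → ℤ
    ∑ = ∑ℤ.sum

  opaque
    unfolding ∑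

    ∑≡sum : ∀ {n} (x : Fin n → ℤ) → ∑ x ≡ ∑ℤ.sum x
    ∑≡sum x = refl

    ∑-suc : ∀ {n} (x : Fin (suc n) → ℤ) → ∑ x ≡ x zero + ∑ (x ∘ suc)
    ∑-suc x = refl

    ∑-cong : ∀ {n} {x y : Fin n → ℤ} → (∀ i → x i ≡ y i) → ∑ x ≡ ∑ y
    ∑-cong x≗y = SumProperties.sum-cong-≗ x≗y

    ∑-+ : ∀ {n} (x y : Fin n → ℤ) → ∑ (λ i → x i + y i) ≡ ∑ x + ∑ y
    ∑-+ x y = SumProperties.∑-distrib-+ x y

    ∑-*ˡ : ∀ {n} a (x : Fin n → ℤ) → ∑ (λ i → a * x i) ≡ a * ∑ x
    ∑-*ˡ a x = sym (SumProperties.*-distribˡ-sum a x)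

    ∑-*ʳ : ∀ {n} a (x : Fin n → ℤ) → ∑ (λ i → x i * a) ≡ ∑ x * a
    ∑-*ʳ a x = sym (SumProperties.*-distribʳ-sum a x)

    ∑-zero : ∀ {n} (x : Fin n → ℤ) → (∀ i → x i ≡ 0ℤ) → ∑ x ≡ 0ℤ
    ∑-zero {n} x x≗0 = trans (SumProperties.sum-cong-≗ x≗0) (SumProperties.sum-replicate-zero n)

    ∑-const : ∀ n a → ∑ {n} (λ _ → a) ≡ + n * a
    ∑-const zero    a = refl
    ∑-const (suc n) a = trans (cong (λ u → a + u) (∑-const n a)) (sym (suc-* (+ n) a))

    ∑-comm : ∀ {m n} (f : Fin m → Fin n → ℤ) →
             ∑ (λ i → ∑ (λ j → f i j)) ≡ ∑ (λ j → ∑ (λ i → f i j))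
    ∑-comm f = SumProperties.∑-comm f

    ∣-∑ : ∀ {n k} {x : Fin n → ℤ} → (∀ i → k ∣ x i) → k ∣ ∑ x
    ∣-∑ {zero}  k∣x = divides 0ℤ refl
    ∣-∑ {suc n} k∣x = ∣m∣n⇒∣m+n (k∣x zero) (∣-∑ (k∣x ∘ suc))

  opaque
    _·_ : ∀ {n} → (Fin n → ℤ) → (Fin n → ℤ) → ℤ
    r · x = ∑ (λ i → r i * x i)

    ·-def : ∀ {n} (r x : Fin n → ℤ) → r · x ≡ ∑ (λ i → r i * x i)
    ·-def r x = refl

  _∙_ : ∀ {m n} → (Fin m → Fin n → ℤ) → (Fin n → ℤ) → Fin m → ℤ
  (M ∙ x) i = M i · x

  ones : ∀ {n} → Fin n → ℤ
  ones _ = 1ℤ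

  opaque
    unfolding _·_

    ·-suc : ∀ {n} (r x : Fin (suc n) → ℤ) → r · x ≡ r zero * x zero + (r ∘ suc) · (x ∘ suc)
    ·-suc r x = ∑-suc (λ i → r i * x i)

    ∣-· : ∀ {n k} (r : Fin n → ℤ) {x} → (∀ i → k ∣ x i) → k ∣ r · x
    ∣-· r k∣x = ∣-∑ (λ i → ∣n⇒∣m*n (r i) (k∣x i))

    ·-congʳ : ∀ {n} (r : Fin n → ℤ) {x y} → (∀ i → x i ≡ y i) → r · x ≡ r · y
    ·-congʳ r x≗y = ∑-cong (λ i → cong (r i *_) (x≗y i))

    ·-comm : ∀ {n} (r x : Fin n → ℤ) → r · x ≡ x · r
    ·-comm r x = ∑-cong (λ i → *-comm (r i) (x i))

    ·-scale : ∀ {n} (r : Fin n → ℤ) a x → r · (λ i → a * x i) ≡ a * (r · x)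
    ·-scale r a x = trans (∑-cong (λ i → swap (r i) a (x i))) (∑-*ˡ a (λ i → r i * x i))
      where
      swap : ∀ r a x → r * (a * x) ≡ a * (r * x)
      swap = solve-∀

    ·-+ : ∀ {n} (r x y : Fin n → ℤ) → r · (λ i → x i + y i) ≡ r · x + r · y
    ·-+ r x y = trans (∑-cong (λ i → *-distribˡ-+ (r i) (x i) (y i)))
                      (∑-+ (λ i → r i * x i) (λ i → r i * y i))

    ·-zero : ∀ {n} (r : Fin n → ℤ) {x} → (∀ i → x i ≡ 0ℤ) → r · x ≡ 0ℤ
    ·-zero {n} r x≗0 = ∑-zero _ (λ i → trans (cong (r i *_) (x≗0 i)) (*-zeroʳ (r i)))

    ·-ones : ∀ {n} (r : Fin n → ℤ) → r · ones ≡ ∑ r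
    ·-ones r = ∑-cong (λ i → *-identityʳ (r i))

    ·-assoc : ∀ {m n} (r : Fin m → ℤ) (M : Fin m → Fin n → ℤ) x →
              r · (M ∙ x) ≡ (λ j → ∑ (λ i → r i * M i j)) · x
    ·-assoc r M x = begin
      ∑ (λ i → r i * ∑ (λ j → M i j * x j))    ≡⟨ ∑-cong (λ i → sym (∑-*ˡ (r i) (λ j → M i j * x j))) ⟩
      ∑ (λ i → ∑ (λ j → r i * (M i j * x j)))  ≡⟨ ∑-comm (λ i j → r i * (M i j * x j)) ⟩
      ∑ (λ j → ∑ (λ i → r i * (M i j * x j)))  ≡⟨ ∑-cong (λ j → ∑-cong (λ i → sym (*-assoc (r i) (M i j) (x j)))) ⟩
      ∑ (λ j → ∑ (λ i → r i * M i j * x j))    ≡⟨ ∑-cong (λ j → ∑-*ʳ (x j) (λ i → r i * M i j)) ⟩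
      ∑ (λ j → ∑ (λ i → r i * M i j) * x j)    ∎

  ones-· : ∀ {n} (x : Fin n → ℤ) → ones · x ≡ ∑ x
  ones-· x = trans (·-comm ones x) (·-ones x)

  ·-linear : ∀ {n} (r : Fin n → ℤ) a b x y →
             r · (λ i → a * x i + b * y i) ≡ a * (r · x) + b * (r · y)
  ·-linear r a b x y = trans (·-+ r (λ i → a * x i) (λ i → b * y i))
                             (cong₂ _+_ (·-scale r a x) (·-scale r b y))

  ∑-linear : ∀ {n} a b (x y : Fin n → ℤ) →
             ∑ (λ i → a * x i + b * y i) ≡ a * ∑ x + b * ∑ y
  ∑-linear a b x y = trans (∑-+ (λ i → a * x i) (λ i → b * y i)) (cong₂ _+_ (∑-*ˡ a x) (∑-*ˡ b y))

  ·-linearˡ : ∀ {n} a b (r s x : Fin n → ℤ) →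
              (λ i → a * r i + b * s i) · x ≡ a * (r · x) + b * (s · x)
  ·-linearˡ a b r s x = begin
    (λ i → a * r i + b * s i) · x  ≡⟨ ·-comm _ x ⟩
    x · (λ i → a * r i + b * s i)  ≡⟨ ·-linear x a b r s ⟩
    a * (x · r) + b * (x · s)      ≡⟨ cong₂ (λ u v → a * u + b * v) (·-comm x r) (·-comm x s) ⟩
    a * (r · x) + b * (s · x)      ∎

  ·-diagonal : ∀ {n} (d : Fin n → ℕ) i x → diagonal d i · x ≡ + d i * x i
  ·-diagonal {suc n} d zero x = begin
    diagonal d zero · x                                ≡⟨ ·-suc (diagonal d zero) x ⟩
    + d zero * x zero + (λ (_ : Fin n) → 0ℤ) · (x ∘ suc)
      ≡⟨ cong (λ u → + d zero * x zero + u) (trans (·-comm _ (x ∘ suc)) (·-zero (x ∘ suc) (λ _ → refl))) ⟩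
    + d zero * x zero + 0ℤ                             ≡⟨ +-identityʳ _ ⟩
    + d zero * x zero                                  ∎
  ·-diagonal {suc n} d (suc i) x = begin
    diagonal d (suc i) · x                             ≡⟨ ·-suc (diagonal d (suc i)) x ⟩
    0ℤ * x zero + diagonal (d ∘ suc) i · (x ∘ suc)
      ≡⟨ cong₂ _+_ (*-zeroˡ (x zero)) (·-diagonal (d ∘ suc) i (x ∘ suc)) ⟩
    0ℤ + + d (suc i) * x (suc i)                       ≡⟨ +-identityˡ _ ⟩
    + d (suc i) * x (suc i)                            ∎

  ·-identity : ∀ {n} i (x : Fin n → ℤ) → identity i · x ≡ x i
  ·-identity i x = trans (·-diagonal (λ _ → 1) i x) (*-identityˡ (x i))

  Nonzero : ∀ {n} → (Fin n → ℤ) → Set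
  Nonzero x = ∃[ i ] x i ≢ 0ℤ

  Kills : ∀ {n} → (Fin n → ℤ) → (Fin n → ℤ) → Set
  Kills x r = r · x ≡ 0ℤ

  -- The remaining rows come with a function that rebuilds `All P rs` from the pivot and the rest,
  -- so no permutation of the rows has to be recorded.
  findPivot : ∀ {n} (rs : List (Fin (suc n) → ℤ)) →
    All (λ r → r zero ≡ 0ℤ) rs ⊎
    (∃[ r ] ∃[ rs′ ] r zero ≢ 0ℤ × length rs ≡ suc (length rs′) ×
      (∀ {P : (Fin (suc n) → ℤ) → Set} → P r → All P rs′ → All P rs))
  findPivot [] = inj₁ []
  findPivot (r ∷ rs) with r zero ≟ 0ℤ
  ... | no r≢0 = inj₂ (r , rs , r≢0 , refl , _∷_)
  ... | yes r≡0 with findPivot rs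
  ...   | inj₁ rs≡0 = inj₁ (r≡0 ∷ rs≡0)
  ...   | inj₂ (s , rs′ , s≢0 , len , split) =
    inj₂ (s , r ∷ rs′ , s≢0 , cong suc len , λ { ps (pr ∷ prs′) → pr ∷ split ps prs′ })

  module _ {n : ℕ} (r : Fin (suc n) → ℤ) where

    -- Cross multiplication in place of division: the entries are the 2 × 2 minors of the rows `r`
    -- and `s` that use their first column.
    eliminate : (Fin (suc n) → ℤ) → Fin n → ℤ
    eliminate s i = r zero * s (suc i) + (- s zero) * r (suc i)

    -- The first unknown is solved from the row `r`, with the denominator `r zero` cleared.
    backSubstitute : (Fin n → ℤ) → Fin (suc n) → ℤ
    backSubstitute x zero    = - ((r ∘ suc) · x)
    backSubstitute x (suc i) = r zero * x i

    backSubstitute-kills : ∀ x s → Kills x (eliminate s) → Kills (backSubstitute x) s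
    backSubstitute-kills x s eq = begin
      s · backSubstitute x
        ≡⟨ ·-suc s (backSubstitute x) ⟩
      s zero * - ((r ∘ suc) · x) + (s ∘ suc) · (λ i → r zero * x i)
        ≡⟨ cong (λ u → s zero * - ((r ∘ suc) · x) + u) (·-scale (s ∘ suc) (r zero) x) ⟩
      s zero * - ((r ∘ suc) · x) + r zero * ((s ∘ suc) · x)
        ≡⟨ swap (s zero) ((r ∘ suc) · x) (r zero) ((s ∘ suc) · x) ⟩
      r zero * ((s ∘ suc) · x) + (- s zero) * ((r ∘ suc) · x)
        ≡⟨ ·-linearˡ (r zero) (- s zero) (s ∘ suc) (r ∘ suc) x ⟨
      eliminate s · x
        ≡⟨ eq ⟩
      0ℤ ∎
      where
      swap : ∀ s R r S → s * - R + r * S ≡ r * S + (- s) * R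
      swap = solve-∀

    eliminate-pivot : ∀ x → Kills x (eliminate r)
    eliminate-pivot x = trans (·-comm (eliminate r) x)
                              (·-zero x (λ i → cancel (r zero) (r (suc i))))
      where
      cancel : ∀ a b → a * b + (- a) * b ≡ 0ℤ
      cancel = solve-∀

  -- Fraction-free Gaussian elimination: a pivot uses up one equation and one unknown, and if the
  -- first column has no pivot, the first unit vector is a solution.
  kernel : ∀ {n} (rs : List (Fin n → ℤ)) → length rs ℕ.< n →
           ∃[ x ] Nonzero x × All (Kills x) rs
  kernel {suc n} rs (ℕ.s≤s len≤) with findPivot rs
  ... | inj₁ rs≡0 = e₀ , (zero , λ ()) , All.map (λ {r} → kills {r}) rs≡0
    where
    e₀ : Fin (suc n) → ℤ
    e₀ zero    = 1ℤ
    e₀ (suc i) = 0ℤ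
    kills : ∀ {r} → r zero ≡ 0ℤ → Kills e₀ r
    kills {r} r≡0 = trans (·-suc r e₀) (cong₂ _+_ (cong (_* 1ℤ) r≡0) (·-zero (r ∘ suc) (λ _ → refl)))
  ... | inj₂ (r , rs′ , r≢0 , len , split)
      with kernel (map (eliminate r) rs′)
             (subst (ℕ._≤ n) (trans len (cong suc (sym (List.length-map (eliminate r) rs′)))) len≤)
  ...   | x , (i , xᵢ≢0) , killed =
    backSubstitute r x , (suc i , rx≢0) ,
    split {Kills (backSubstitute r x)} (backSubstitute-kills r x r (eliminate-pivot r x))
          (All.map (λ {s} → backSubstitute-kills r x s) (All.map⁻ killed))
    where
    rx≢0 : r zero * x i ≢ 0ℤ
    rx≢0 eq with i*j≡0⇒i≡0∨j≡0 (r zero) eq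
    ... | inj₁ r≡0 = r≢0 r≡0
    ... | inj₂ x≡0 = xᵢ≢0 x≡0

-- Counting the exponents below and above a threshold

module Counting where

  open ≡

  indices : ∀ {n} {P : Pred ℕ 0ℓ} → Decidable P → (Fin n → ℕ) → List (Fin n)
  indices P? a = filter (P? ∘ a) (allFin _)

  length-filter-tabulate : ∀ {m n} {P : Pred ℕ 0ℓ} (P? : Decidable P) (a : Fin m → ℕ) (g : Fin n → Fin m) →
    length (filter (P? ∘ a) (List.tabulate g)) ≡ count P? (tabulate (a ∘ g))
  length-filter-tabulate {n = zero}  P? a g = refl
  length-filter-tabulate {n = suc n} P? a g with does (P? (a (g zero)))
  ... | Bool.true  = cong suc (length-filter-tabulate P? a (g ∘ suc))
  ... | Bool.false = length-filter-tabulate P? a (g ∘ suc)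

  length-indices : ∀ {n} {P : Pred ℕ 0ℓ} (P? : Decidable P) (a : Fin n → ℕ) →
    length (indices P? a) ≡ count P? (tabulate a)
  length-indices P? a = length-filter-tabulate P? a (λ i → i)

  All-indices : ∀ {n} {P : Pred ℕ 0ℓ} (P? : Decidable P) (a : Fin n → ℕ)
    {B : Set} {R : Pred B 0ℓ} (f : Fin n → B) → All R (map f (indices P? a)) → ∀ j → P (a j) → R (f j)
  All-indices P? a f all j Paj = All.lookup (All.map⁻ all) (∈-filter⁺ (P? ∘ a) (∈-allFin j) Paj)

  -- The cumulative form of the multiplicities: every claim of the theorem becomes a statement on
  -- the values or increments of `below a`.
  below : ∀ {n} → (Fin n → ℕ) → ℕ → ℕ
  below a k = count (ℕ._<? k) (tabulate a)

  module _ {P Q R : Pred ℕ 0ℓ} (P? : Decidable P) (Q? : Decidable Q) (R? : Decidable R) where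

    count-⊎ : (∀ {x} → R x → P x ⊎ Q x) → (∀ {x} → P x → R x) → (∀ {x} → Q x → R x) →
              (∀ {x} → P x → ¬ Q x) →
              ∀ {n} (v : Vec.Vec ℕ n) → count P? v ℕ.+ count Q? v ≡ count R? v
    count-⊎ R⇒P⊎Q P⇒R Q⇒R P⇒¬Q Vec.[] = refl
    count-⊎ R⇒P⊎Q P⇒R Q⇒R P⇒¬Q (x Vec.∷ v) with P? x | Q? x | R? x | count-⊎ R⇒P⊎Q P⇒R Q⇒R P⇒¬Q v
    ... | yes px | yes qx | _      | _  = contradiction qx (P⇒¬Q px)
    ... | yes px | no  _  | yes _  | ih = cong suc ih
    ... | yes px | no  _  | no ¬rx | _  = contradiction (P⇒R px) ¬rx
    ... | no  _  | yes _  | yes _  | ih = trans (ℕ.+-suc _ _) (cong suc ih)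
    ... | no  _  | yes qx | no ¬rx | _  = contradiction (Q⇒R qx) ¬rx
    ... | no  _  | no  _  | no  _  | ih = ih
    ... | no ¬px | no ¬qx | yes rx | _  with R⇒P⊎Q rx
    ...   | inj₁ px = contradiction px ¬px
    ...   | inj₂ qx = contradiction qx ¬qx

  module _ {P Q : Pred ℕ 0ℓ} (P? : Decidable P) (Q? : Decidable Q) where

    count-⊆ : (∀ {x} → P x → Q x) → ∀ {n} (v : Vec.Vec ℕ n) → count P? v ℕ.≤ count Q? v
    count-⊆ P⇒Q Vec.[] = ℕ.z≤n
    count-⊆ P⇒Q (x Vec.∷ v) with P? x | Q? x | count-⊆ P⇒Q v
    ... | yes _  | yes _  | ih = ℕ.s≤s ih
    ... | yes px | no ¬qx | _  = contradiction (P⇒Q px) ¬qx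
    ... | no  _  | yes _  | ih = ℕ.m≤n⇒m≤1+n ih
    ... | no  _  | no  _  | ih = ih

  module _ {P : Pred ℕ 0ℓ} (P? : Decidable P) where

    count-all : ∀ {n} (a : Fin n → ℕ) → (∀ j → P (a j)) → count P? (tabulate a) ≡ n
    count-all {zero}  a Pa = refl
    count-all {suc n} a Pa with P? (a zero)
    ... | yes _  = cong suc (count-all (a ∘ suc) (Pa ∘ suc))
    ... | no ¬pa = contradiction (Pa zero) ¬pa

  above : ∀ {n} → (Fin n → ℕ) → ℕ → ℕ
  above a k = count (k ℕ.≤?_) (tabulate a)

  below+above : ∀ {n} (a : Fin n → ℕ) k → below a k ℕ.+ above a k ≡ n
  below+above a k = trans
    (count-⊎ (ℕ._<? k) (k ℕ.≤?_) U? (λ {x} _ → ℕ.<-≤-connex x k) _ _ ℕ.<⇒≱ (tabulate a))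
    (count-all U? a _)

  below-mono-≤ : ∀ {n} (a : Fin n → ℕ) {k l} → k ℕ.≤ l → below a k ℕ.≤ below a l
  below-mono-≤ a {k} {l} k≤l =
    count-⊆ (ℕ._<? k) (ℕ._<? l) (λ x<k → ℕ.<-≤-trans x<k k≤l) (tabulate a)

  below-suc : ∀ {n} (a : Fin n → ℕ) k → count (ℕ._≟ k) (tabulate a) ℕ.+ below a k ≡ below a (suc k)
  below-suc a k = count-⊎ (ℕ._≟ k) (ℕ._<? k) (ℕ._<? suc k)
    (λ x<1+k → Sum.swap (ℕ.m≤n⇒m<n∨m≡n (ℕ.s≤s⁻¹ x<1+k)))
    (λ { refl → ℕ.≤-refl }) ℕ.m<n⇒m<1+n (λ { refl → ℕ.<-irrefl refl }) (tabulate a)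

  below-all : ∀ {n} (a : Fin n → ℕ) k → (∀ j → a j ℕ.< k) → below a k ≡ n
  below-all a k = count-all (ℕ._<? k) a

-- Smith normal form as a change of coordinates

module SmithForm where

  open ≡

  open import Data.Integer.Base as ℤ using (+_; _*_)
  open import Data.Integer.Properties
  open import Data.Integer.Divisibility.Signed
  open import Data.Integer.Tactic.RingSolver using (solve-∀)
  open LinearForms
  open Counting
  open ≡-Reasoning

  ∙-∙ : ∀ {n} (M M′ : Matrix n) x i → (M ∙ (M′ ∙ x)) i ≡ ((M *ₘ M′) ∙ x) i
  ∙-∙ M M′ x i = begin
    M i · (M′ ∙ x)                        ≡⟨ ·-assoc (M i) M′ x ⟩
    (λ j → ∑ (λ k → M i k * M′ k j)) · x  ≡⟨ ·-comm _ x ⟩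
    x · (λ j → ∑ (λ k → M i k * M′ k j))  ≡⟨ ·-congʳ x (λ j → ∑≡sum _) ⟩
    x · (M *ₘ M′) i                       ≡⟨ ·-comm x _ ⟩
    (M *ₘ M′) i · x                       ∎

  ·-congˡ : ∀ {n} {r s : Fin n → ℤ} x → (∀ i → r i ≡ s i) → r · x ≡ s · x
  ·-congˡ {r = r} {s} x r≗s = trans (·-comm r x) (trans (·-congʳ x r≗s) (·-comm x s))

  ∙-inverse : ∀ {n} (M M′ : Matrix n) → M *ₘ M′ ≈ₘ identity → ∀ x i → (M ∙ (M′ ∙ x)) i ≡ x i
  ∙-inverse M M′ eq x i = trans (∙-∙ M M′ x i) (trans (·-congˡ x (eq i)) (·-identity i x))

  module Transforms {N : ℕ} (A : Matrix N) (snf : SmithNormalForm A) where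

    open SmithNormalForm snf public

    P⁻¹ Q⁻¹ : Matrix N
    P⁻¹ = proj₁ P-invertible
    Q⁻¹ = proj₁ Q-invertible

    PP⁻¹ : ∀ x i → (P ∙ (P⁻¹ ∙ x)) i ≡ x i
    PP⁻¹ = ∙-inverse P P⁻¹ (proj₁ (proj₂ P-invertible))

    P⁻¹P : ∀ x i → (P⁻¹ ∙ (P ∙ x)) i ≡ x i
    P⁻¹P = ∙-inverse P⁻¹ P (proj₂ (proj₂ P-invertible))

    QQ⁻¹ : ∀ x i → (Q ∙ (Q⁻¹ ∙ x)) i ≡ x i
    QQ⁻¹ = ∙-inverse Q Q⁻¹ (proj₁ (proj₂ Q-invertible))

    Q⁻¹Q : ∀ x i → (Q⁻¹ ∙ (Q ∙ x)) i ≡ x i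
    Q⁻¹Q = ∙-inverse Q⁻¹ Q (proj₂ (proj₂ Q-invertible))

    PAQ : ∀ z j → (P ∙ (A ∙ (Q ∙ z))) j ≡ + d j * z j
    PAQ z j = begin
      (P ∙ (A ∙ (Q ∙ z))) j    ≡⟨ ∙-∙ P A (Q ∙ z) j ⟩
      ((P *ₘ A) ∙ (Q ∙ z)) j   ≡⟨ ∙-∙ (P *ₘ A) Q z j ⟩
      ((P *ₘ A *ₘ Q) ∙ z) j    ≡⟨ ·-congˡ z (PAQ≈diagonal j) ⟩
      (diagonal d ∙ z) j       ≡⟨ ·-diagonal d j z ⟩
      + d j * z j              ∎

    PA : ∀ y j → (P ∙ (A ∙ y)) j ≡ + d j * (Q⁻¹ ∙ y) j
    PA y j = trans (·-congʳ (P j) (λ i → ·-congʳ (A i) (λ k → sym (QQ⁻¹ y k)))) (PAQ (Q⁻¹ ∙ y) j)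

    AQ : ∀ z i → (A ∙ (Q ∙ z)) i ≡ (P⁻¹ ∙ (λ j → + d j * z j)) i
    AQ z i = trans (sym (P⁻¹P _ i)) (·-congʳ (P⁻¹ i) (PAQ z))

    -- A unimodular change of coordinates neither creates nor destroys a common divisor, so
    -- divisibility of a vector can be tested before or after `P`, `Q` or their inverses.
    ∣-Q⁻¹ : ∀ {k z} → (∀ j → k ∣ (Q⁻¹ ∙ z) j) → ∀ i → k ∣ z i
    ∣-Q⁻¹ {k} {z} k∣ i = subst (k ∣_) (QQ⁻¹ z i) (∣-· (Q i) k∣)

    ∣-Q : ∀ {k z} → (∀ j → k ∣ (Q ∙ z) j) → ∀ i → k ∣ z i
    ∣-Q {k} {z} k∣ i = subst (k ∣_) (Q⁻¹Q z i) (∣-· (Q⁻¹ i) k∣)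

    ∣-P : ∀ {k z} → (∀ j → k ∣ (P ∙ z) j) → ∀ i → k ∣ z i
    ∣-P {k} {z} k∣ i = subst (k ∣_) (P⁻¹P z i) (∣-· (P⁻¹ i) k∣)

    ∣-P⁻¹ : ∀ {k z} → (∀ j → k ∣ (P⁻¹ ∙ z) j) → ∀ i → k ∣ z i
    ∣-P⁻¹ {k} {z} k∣ i = subst (k ∣_) (PP⁻¹ z i) (∣-· (P i) k∣)

  module Powers (p : ℕ) (1<p : 1 ℕ.< p) where

    pow : ℕ → ℤ
    pow k = + (p ℕ.^ k)

    pow-+ : ∀ i j → pow (i ℕ.+ j) ≡ pow i * pow j
    pow-+ i j = trans (cong +_ (ℕ.^-distribˡ-+-* p i j)) (pos-* (p ℕ.^ i) (p ℕ.^ j))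

    pow-suc : ∀ k → pow (suc k) ≡ + p * pow k
    pow-suc k = pos-* p (p ℕ.^ k)

    private instance
      p-nonZero : ℕ.NonZero p
      p-nonZero = ℕ.>-nonZero (ℕ.<-trans ℕ.0<1+n 1<p)

    pow-nonZero : ∀ k → ℤ.NonZero (pow k)
    pow-nonZero k = ℕ.m^n≢0 p k

    pow≢0 : ∀ k → pow k ≢ 0ℤ
    pow≢0 k eq = ℕ.≢-nonZero⁻¹ (p ℕ.^ k) {{ℕ.m^n≢0 p k}} (+-injective eq)

    pow-mono-∣ : ∀ {i j} → i ℕ.≤ j → pow i ∣ pow j
    pow-mono-∣ {i} {j} i≤j = divides (pow (j ℕ.∸ i))
      (trans (cong pow (sym (ℕ.m∸n+n≡m i≤j))) (pow-+ (j ℕ.∸ i) i))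

    p∣pow : ∀ {k} → 0 ℕ.< k → + p ∣ pow k
    p∣pow {k} 0<k = subst (_∣ pow k) (cong +_ (ℕ.*-identityʳ p)) (pow-mono-∣ 0<k)

    pow-cancel-∣ : ∀ {i j x} → i ℕ.< j → pow j ∣ pow i * x → + p ∣ x
    pow-cancel-∣ {i} {j} {x} i<j pʲ∣pⁱx =
      *-cancelˡ-∣ (pow i) {{pow-nonZero i}}
        (subst (_∣ pow i * x) (trans (pow-suc i) (*-comm (+ p) (pow i))) (∣-trans (pow-mono-∣ i<j) pʲ∣pⁱx))

    -- Primitive at `p` only: the reduction modulo `p` is nonzero, while other common divisors are
    -- allowed.
    Primitive : ∀ {n} → (Fin n → ℤ) → Set
    Primitive x = ¬ (∀ i → + p ∣ x i)

    -- Each division by `p` shrinks the absolute value of one fixed nonzero coordinate, which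
    -- therefore serves as fuel.
    primitivePart : ∀ {n} (x : Fin n → ℤ) → Nonzero x →
      ∃[ l ] ∃[ y ] (∀ i → x i ≡ pow l * y i) × Primitive y
    primitivePart x (i₀ , x≢0) = go ℤ.∣ x i₀ ∣ x ℕ.≤-refl x≢0
      where
      go : ∀ f (x : _ → ℤ) → ℤ.∣ x i₀ ∣ ℕ.≤ f → x i₀ ≢ 0ℤ →
           ∃[ l ] ∃[ y ] (∀ i → x i ≡ pow l * y i) × Primitive y
      go f x ∣x∣≤f x≢0 with Fin.all? (λ i → + p ∣? x i)
      go f x ∣x∣≤f x≢0 | no ¬p∣x = 0 , x , (λ i → sym (*-identityˡ (x i))) , ¬p∣x
      go zero x ∣x∣≤0 x≢0 | yes p∣x = contradiction (∣i∣≡0⇒i≡0 (ℕ.n≤0⇒n≡0 ∣x∣≤0)) x≢0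
      go (suc f) x ∣x∣≤f x≢0 | yes p∣x with go f x/p smaller x/p≢0
        where
        x/p : _ → ℤ
        x/p i = quotient (p∣x i)
        eq : x i₀ ≡ x/p i₀ * + p
        eq = _∣_.equality (p∣x i₀)
        x/p≢0 : x/p i₀ ≢ 0ℤ
        x/p≢0 q≡0 = x≢0 (trans eq (cong (_* + p) q≡0))
        smaller : ℤ.∣ x/p i₀ ∣ ℕ.≤ f
        smaller = ℕ.s≤s⁻¹ (ℕ.<-≤-trans
          (subst (ℤ.∣ x/p i₀ ∣ ℕ.<_) (sym (trans (cong ℤ.∣_∣ eq) (abs-* (x/p i₀) (+ p))))
            (ℕ.m<m*n _ p {{ℤ.≢-nonZero x/p≢0}} 1<p))
          ∣x∣≤f)
      ... | l , y , eq , prim = suc l , y , eq′ , prim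
        where
        swap : ∀ a b c → a * b * c ≡ c * a * b
        swap = solve-∀
        eq′ : ∀ i → x i ≡ pow (suc l) * y i
        eq′ i = begin
          x i                         ≡⟨ _∣_.equality (p∣x i) ⟩
          quotient (p∣x i) * + p      ≡⟨ cong (_* + p) (eq i) ⟩
          pow l * y i * + p           ≡⟨ swap (pow l) (y i) (+ p) ⟩
          + p * pow l * y i           ≡⟨ cong (_* y i) (pow-suc l) ⟨
          pow (suc l) * y i           ∎

    -- Two bounds on exponent counts from primitive vectors

    module Bounds {N : ℕ} (A : Matrix N) (snf : SmithNormalForm A) (a : Fin N → ℕ)
                  (d≡pᵃ : ∀ j → SmithNormalForm.d snf j ≡ p ℕ.^ a j) where

      open Transforms A snf

      pow-a : ∀ j → + d j ≡ pow (a j)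
      pow-a j = cong +_ (d≡pᵃ j)

      length-++-maps : ∀ {I B : Set} (ws : List B) (f : I → B) is → length (ws ++ map f is) ≡ length ws ℕ.+ length is
      length-++-maps ws f is = trans (List.length-++ ws) (cong (length ws ℕ.+_) (List.length-map f is))

      -- More than |ws| exponents a_j ≥ k leave a primitive x in the span of the
      -- corresponding columns of Q that is killed by ws.
      above-≤ : ∀ k (ws : List (Fin N → ℤ)) →
        (∀ x → All (Kills x) ws → (∀ i → pow k ∣ (A ∙ x) i) → ∀ i → + p ∣ x i) →
        N ℕ.≤ below a k ℕ.+ length ws
      above-≤ k ws killed⇒p∣ = ℕ.≮⇒≥ absurd
        where
        w∘Q : (Fin N → ℤ) → Fin N → ℤ
        w∘Q w j = ∑ (λ i → w i * Q i j)
        -- As equations in `z`: `Q ∙ z` is killed by `ws`, and `z j` vanishes whenever `a j < k`,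
        -- which makes every `d j * z j` divisible by `p ^ k`.
        rows : List (Fin N → ℤ)
        rows = map w∘Q ws ++ map identity (indices (ℕ._<? k) a)
        length-rows : length rows ≡ below a k ℕ.+ length ws
        length-rows = trans (length-++-maps (map w∘Q ws) identity _)
          (trans (cong₂ ℕ._+_ (List.length-map w∘Q ws) (length-indices (ℕ._<? k) a)) (ℕ.+-comm (length ws) _))
        absurd : ¬ (below a k ℕ.+ length ws ℕ.< N)
        absurd lt with kernel rows (subst (ℕ._< N) (sym length-rows) lt)
        ... | z₀ , z₀≢0 , killed with primitivePart z₀ z₀≢0
        ...   | l , z , z₀≡ , prim = prim p∣z
          where
          kills-z : ∀ {r} → Kills z₀ r → Kills z r
          kills-z {r} r·z₀≡0 with i*j≡0⇒i≡0∨j≡0 (pow l)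
            (trans (sym (·-scale r (pow l) z)) (trans (·-congʳ r (λ i → sym (z₀≡ i))) r·z₀≡0))
          ... | inj₁ p≡0 = contradiction p≡0 (pow≢0 l)
          ... | inj₂ eq  = eq
          killed-z : All (Kills z) rows
          killed-z = All.map (λ {r} → kills-z {r}) killed
          z≡0 : ∀ j → a j ℕ.< k → z j ≡ 0ℤ
          z≡0 j aⱼ<k = trans (sym (·-identity j z))
            (All-indices (ℕ._<? k) a identity (All.++⁻ʳ (map w∘Q ws) killed-z) j aⱼ<k)
          killed-Qz : All (Kills (Q ∙ z)) ws
          killed-Qz = All.map (λ {w} eq → trans (·-assoc w Q z) eq) (All.map⁻ (All.++⁻ˡ (map w∘Q ws) killed-z))
          pᵏ∣ : ∀ j → pow k ∣ + d j * z j
          pᵏ∣ j with a j ℕ.<? k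
          ... | yes aⱼ<k = divides 0ℤ (trans (cong (+ d j *_) (z≡0 j aⱼ<k)) (*-zeroʳ (+ d j)))
          ... | no  aⱼ≮k = ∣m⇒∣m*n (z j) (subst (pow k ∣_) (sym (pow-a j)) (pow-mono-∣ (ℕ.≮⇒≥ aⱼ≮k)))
          pᵏ∣AQz : ∀ i → pow k ∣ (A ∙ (Q ∙ z)) i
          pᵏ∣AQz i = subst (pow k ∣_) (sym (AQ z i)) (∣-· (P⁻¹ i) pᵏ∣)
          p∣z : ∀ j → + p ∣ z j
          p∣z j = ∣-Q (killed⇒p∣ (Q ∙ z) killed-Qz pᵏ∣AQz) j

      -- An integer combination of given columns need not be primitive, so it is replaced by a
      -- rational multiple `y` of it. A linear form that kills `x` kills `y` too, because `s` is
      -- nonzero and ℤ has no zero divisors.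
      record PrimitiveMultiple (k : ℕ) (x : Fin N → ℤ) : Set where
        field
          r s       : ℤ
          s≢0       : s ≢ 0ℤ
          y         : Fin N → ℤ
          sy≡rx     : ∀ i → s * y i ≡ r * x i
          primitive-y : Primitive y
          pᵏ∣Ay     : ∀ i → pow k ∣ (A ∙ y) i

      -- If y is primitive and pᵏ divides A y, then some coordinate of Q⁻¹ y with
      -- a_j ≥ k is prime to p.
      below-≤ : ∀ k n (ws : List (Fin n → ℤ)) (M : Fin N → Fin n → ℤ) →
        (∀ x → Nonzero x → All (Kills x) ws → PrimitiveMultiple k (M ∙ x)) →
        below a k ℕ.+ n ℕ.≤ N ℕ.+ length ws
      below-≤ k n ws M mult = ℕ.≮⇒≥ absurd
        where
        row : Fin N → Fin n → ℤ
        row j c = ∑ (λ i → Q⁻¹ j i * M i c)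
        -- Besides `ws`, the equations ask that the coordinates of `Q⁻¹ ∙ (M ∙ x)` with `k ≤ a j`
        -- vanish: `above a k` further conditions on `n` unknowns.
        rows : List (Fin n → ℤ)
        rows = ws ++ map row (indices (k ℕ.≤?_) a)
        length-rows : length rows ≡ length ws ℕ.+ above a k
        length-rows = trans (length-++-maps ws row _) (cong (length ws ℕ.+_) (length-indices (k ℕ.≤?_) a))
        few-rows : N ℕ.+ length ws ℕ.< below a k ℕ.+ n → length rows ℕ.< n
        few-rows lt = ℕ.+-cancelˡ-< (below a k) _ _ (subst (ℕ._< below a k ℕ.+ n) eq lt)
          where
          eq : N ℕ.+ length ws ≡ below a k ℕ.+ length rows
          eq = trans (cong (ℕ._+ length ws) (sym (below+above a k)))
               (trans (ℕ.+-assoc (below a k) (above a k) (length ws))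
               (cong (below a k ℕ.+_) (trans (ℕ.+-comm (above a k) (length ws)) (sym length-rows))))
        absurd : ¬ (N ℕ.+ length ws ℕ.< below a k ℕ.+ n)
        absurd lt with kernel rows (few-rows lt)
        ... | x , x≢0 , killed = primitive-y (∣-Q⁻¹ p∣z)
          where
          open PrimitiveMultiple (mult x x≢0 (All.++⁻ˡ ws killed))
          z≡0 : ∀ j → k ℕ.≤ a j → (Q⁻¹ ∙ y) j ≡ 0ℤ
          z≡0 j k≤aⱼ with i*j≡0⇒i≡0∨j≡0 s eq
            where
            eq : s * (Q⁻¹ ∙ y) j ≡ 0ℤ
            eq = begin
              s * (Q⁻¹ ∙ y) j                   ≡⟨ ·-scale (Q⁻¹ j) s y ⟨
              Q⁻¹ j · (λ i → s * y i)           ≡⟨ ·-congʳ (Q⁻¹ j) sy≡rx ⟩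
              Q⁻¹ j · (λ i → r * (M ∙ x) i)     ≡⟨ ·-scale (Q⁻¹ j) r (M ∙ x) ⟩
              r * (Q⁻¹ j · (M ∙ x))             ≡⟨ cong (r *_) (·-assoc (Q⁻¹ j) M x) ⟩
              r * (row j · x)
                ≡⟨ cong (r *_) (All-indices (k ℕ.≤?_) a row (All.++⁻ʳ ws killed) j k≤aⱼ) ⟩
              r * 0ℤ                            ≡⟨ *-zeroʳ r ⟩
              0ℤ                                ∎
          ... | inj₁ s≡0 = contradiction s≡0 s≢0
          ... | inj₂ eq  = eq
          p∣z : ∀ j → + p ∣ (Q⁻¹ ∙ y) j
          p∣z j with a j ℕ.<? k
          -- `p ^ k` divides `(P ∙ (A ∙ y)) j`, which is `p ^ a j` times the coordinate of
          -- `Q⁻¹ ∙ y`; as `a j < k`, a factor `p` is left for the coordinate.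
          ... | yes aⱼ<k = pow-cancel-∣ aⱼ<k (subst (pow k ∣_) (trans (PA y j) (cong (_* (Q⁻¹ ∙ y) j) (pow-a j))) (∣-· (P j) pᵏ∣Ay))
          ... | no  aⱼ≮k = divides 0ℤ (trans (z≡0 j (ℕ.≮⇒≥ aⱼ≮k)) refl)

-- Matrix identities for points, lines and skewness

module LineSpace where

  open ≡

  open import Data.Integer.Base as ℤ using (+_; +[1+_]; _+_; _*_; _-_; -_)
  open import Data.Integer.Properties
  open import Data.Integer.Divisibility.Signed
  open import Data.Integer.Tactic.RingSolver using (solve-∀)
  open LinearForms
  open SmithForm using (·-congˡ)
  open ≡-Reasoning

  -- The order q is given by its predecessor n, so that q, q + 1, … are nonzero by computation.
  record SkewnessData (n N m : ℕ) (A : Matrix N) (M : Fin N → Fin m → ℤ) : Set where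
    q : ℤ
    q = +[1+ n ]

    field
      points        : + m ≡ q * q * q + q * q + q + 1ℤ
      skewness      : ∀ i k → A i k ≡ q * identity i k + 1ℤ - M i · M k
      idempotent    : ∀ i r → M i r * M i r ≡ M i r
      line-size     : ∀ i → ∑ (M i) ≡ q + 1ℤ
      unique-line   : ∀ r s → r ≢ s → (λ i → M i r) · (λ i → M i s) ≡ 1ℤ

  module Identities {n N m : ℕ} {A : Matrix N} {M : Fin N → Fin m → ℤ}
                    (G : SkewnessData n N m A M) where

    open SkewnessData G

    Mᵀ : Fin m → Fin N → ℤ
    Mᵀ r i = M i r

    MᵀM-entry : ∀ r s → Mᵀ r · Mᵀ s ≡ (∑ (Mᵀ r) - 1ℤ) * identity r s + 1ℤ * 1ℤ
    MᵀM-entry r s with r Fin.≟ s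
    ... | yes refl = trans (trans (·-def (Mᵀ r) (Mᵀ r)) (∑-cong (λ i → idempotent i r))) (lemma (∑ (Mᵀ r)))
      where
      lemma : ∀ c → c ≡ (c - 1ℤ) * 1ℤ + 1ℤ * 1ℤ
      lemma = solve-∀
    ... | no r≢s = trans (unique-line r s r≢s) (sym (cong (_+ 1ℤ) (*-zeroʳ (∑ (Mᵀ r) - 1ℤ))))

    -- Stated while the number of lines through a point is still unknown; at the all-ones vector it
    -- yields the equation from which `degree` computes that number.
    MᵀM-degree : ∀ y r → (Mᵀ ∙ (M ∙ y)) r ≡ (∑ (Mᵀ r) - 1ℤ) * y r + ∑ y
    MᵀM-degree y r = begin
      Mᵀ r · (M ∙ y)                                             ≡⟨ ·-assoc (Mᵀ r) M y ⟩
      (λ s → ∑ (λ i → Mᵀ r i * M i s)) · y                       ≡⟨ ·-congˡ y (λ s → trans (sym (·-def (Mᵀ r) (Mᵀ s))) (MᵀM-entry r s)) ⟩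
      (λ s → (∑ (Mᵀ r) - 1ℤ) * identity r s + 1ℤ * ones s) · y   ≡⟨ ·-linearˡ (∑ (Mᵀ r) - 1ℤ) 1ℤ (identity r) ones y ⟩
      (∑ (Mᵀ r) - 1ℤ) * (identity r · y) + 1ℤ * (ones · y)
        ≡⟨ cong₂ (λ u v → (∑ (Mᵀ r) - 1ℤ) * u + v) (·-identity r y) (trans (*-identityˡ _) (ones-· y)) ⟩
      (∑ (Mᵀ r) - 1ℤ) * y r + ∑ y                                ∎

    ∑-ones : ∀ k → ∑ {k} ones ≡ + k
    ∑-ones k = trans (∑-const k 1ℤ) (*-identityʳ (+ k))

    M-const : ∀ a i → M i · (λ _ → a) ≡ a * (q + 1ℤ)
    M-const a i = begin
      M i · (λ _ → a)           ≡⟨ ·-congʳ (M i) (λ _ → sym (*-identityʳ a)) ⟩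
      M i · (λ r → a * ones r)  ≡⟨ ·-scale (M i) a ones ⟩
      a * (M i · ones)          ≡⟨ cong (a *_) (trans (·-ones (M i)) (line-size i)) ⟩
      a * (q + 1ℤ)              ∎

    -- Double counting of the pairs of a line through `r` and a point on it: each of the `c` lines
    -- has q + 1 points, while `r` lies on all `c` of them and every other point on exactly one.
    degree : ∀ r → ∑ (Mᵀ r) ≡ q * q + q + 1ℤ
    degree r = *-cancelˡ-≡ q _ _ (begin
      q * c                             ≡⟨ isolate q c ⟩
      c * (q + 1ℤ) - c                  ≡⟨ cong (_- c) double-count ⟩
      (c - 1ℤ) * 1ℤ + + m - c           ≡⟨ cong (λ u → (c - 1ℤ) * 1ℤ + u - c) points ⟩
      (c - 1ℤ) * 1ℤ + (q * q * q + q * q + q + 1ℤ) - c  ≡⟨ collect q c ⟩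
      q * (q * q + q + 1ℤ)              ∎)
      where
      c = ∑ (Mᵀ r)
      isolate : ∀ q c → q * c ≡ c * (q + 1ℤ) - c
      isolate = solve-∀
      collect : ∀ q c → (c - 1ℤ) * 1ℤ + (q * q * q + q * q + q + 1ℤ) - c ≡ q * (q * q + q + 1ℤ)
      collect = solve-∀
      double-count : c * (q + 1ℤ) ≡ (c - 1ℤ) * 1ℤ + + m
      double-count = begin
        c * (q + 1ℤ)                        ≡⟨ *-comm c (q + 1ℤ) ⟩
        (q + 1ℤ) * c                        ≡⟨ cong ((q + 1ℤ) *_) (·-ones (Mᵀ r)) ⟨
        (q + 1ℤ) * (Mᵀ r · ones)            ≡⟨ ·-scale (Mᵀ r) (q + 1ℤ) ones ⟨
        Mᵀ r · (λ i → (q + 1ℤ) * 1ℤ)        ≡⟨ ·-congʳ (Mᵀ r) (λ i → trans (*-comm (q + 1ℤ) 1ℤ) (sym (M-const 1ℤ i))) ⟩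
        Mᵀ r · (M ∙ ones)                   ≡⟨ MᵀM-degree ones r ⟩
        (c - 1ℤ) * 1ℤ + ∑ {m} ones          ≡⟨ cong (λ u → (c - 1ℤ) * 1ℤ + u) (∑-ones m) ⟩
        (c - 1ℤ) * 1ℤ + + m                 ∎

    MᵀM : ∀ y r → (Mᵀ ∙ (M ∙ y)) r ≡ (q * q + q) * y r + ∑ y
    MᵀM y r = trans (MᵀM-degree y r) (trans (cong (λ c → (c - 1ℤ) * y r + ∑ y) (degree r)) (lemma q (y r) (∑ y)))
      where
      lemma : ∀ q y σ → (q * q + q + 1ℤ - 1ℤ) * y + σ ≡ (q * q + q) * y + σ
      lemma = solve-∀

    ∑-∙ : ∀ {k l} (B : Fin k → Fin l → ℤ) a → (∀ j → ∑ (λ i → B i j) ≡ a) → ∀ x → ∑ (B ∙ x) ≡ a * ∑ x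
    ∑-∙ B a col x = begin
      ∑ (B ∙ x)                                ≡⟨ ones-· (B ∙ x) ⟨
      ones · (B ∙ x)                           ≡⟨ ·-assoc ones B x ⟩
      (λ j → ∑ (λ i → 1ℤ * B i j)) · x         ≡⟨ ·-comm _ x ⟩
      x · (λ j → ∑ (λ i → 1ℤ * B i j))
        ≡⟨ ·-congʳ x (λ j → trans (∑-*ˡ 1ℤ (λ i → B i j)) (trans (*-identityˡ _) (trans (col j) (sym (*-identityʳ a))))) ⟩
      x · (λ j → a * ones j)                   ≡⟨ ·-scale x a ones ⟩
      a * (x · ones)                           ≡⟨ cong (a *_) (·-ones x) ⟩
      a * ∑ x                                  ∎

    ∑-M : ∀ y → ∑ (M ∙ y) ≡ (q * q + q + 1ℤ) * ∑ y
    ∑-M = ∑-∙ M (q * q + q + 1ℤ) degree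

    ∑-Mᵀ : ∀ x → ∑ (Mᵀ ∙ x) ≡ (q + 1ℤ) * ∑ x
    ∑-Mᵀ = ∑-∙ Mᵀ (q + 1ℤ) line-size

    -- Incident point-line pairs, counted by lines and by points.
    lines : + N ≡ (q * q + 1ℤ) * (q * q + q + 1ℤ)
    lines = *-cancelˡ-≡ (q + 1ℤ) _ _ (begin
      (q + 1ℤ) * + N                              ≡⟨ *-comm (q + 1ℤ) (+ N) ⟩
      + N * (q + 1ℤ)                              ≡⟨ ∑-const N (q + 1ℤ) ⟨
      ∑ {N} (λ _ → q + 1ℤ)                        ≡⟨ ∑-cong (λ i → trans (M-const 1ℤ i) (*-identityˡ (q + 1ℤ))) ⟨
      ∑ (M ∙ ones)                                ≡⟨ ∑-M ones ⟩
      (q * q + q + 1ℤ) * ∑ {m} ones               ≡⟨ cong ((q * q + q + 1ℤ) *_) (trans (∑-ones m) points) ⟩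
      (q * q + q + 1ℤ) * (q * q * q + q * q + q + 1ℤ)  ≡⟨ lemma q ⟩
      (q + 1ℤ) * ((q * q + 1ℤ) * (q * q + q + 1ℤ))  ∎)
      where
      lemma : ∀ q → (q * q + q + 1ℤ) * (q * q * q + q * q + q + 1ℤ) ≡ (q + 1ℤ) * ((q * q + 1ℤ) * (q * q + q + 1ℤ))
      lemma = solve-∀

    MMᵀ : ∀ x i → (M ∙ (Mᵀ ∙ x)) i ≡ q * x i + ∑ x - (A ∙ x) i
    MMᵀ x i = begin
      M i · (Mᵀ ∙ x)                                    ≡⟨ ·-assoc (M i) Mᵀ x ⟩
      (λ k → ∑ (λ r → M i r * M k r)) · x               ≡⟨ ·-congˡ x (λ k → trans (sym (·-def (M i) (M k))) (entry k)) ⟩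
      (λ k → 1ℤ * (q * identity i k + 1ℤ * 1ℤ) + (- 1ℤ) * A i k) · x
        ≡⟨ ·-linearˡ 1ℤ (- 1ℤ) (λ k → q * identity i k + 1ℤ * 1ℤ) (A i) x ⟩
      1ℤ * ((λ k → q * identity i k + 1ℤ * 1ℤ) · x) + (- 1ℤ) * (A i · x)
        ≡⟨ cong (λ u → 1ℤ * u + (- 1ℤ) * (A i · x)) (·-linearˡ q 1ℤ (identity i) ones x) ⟩
      1ℤ * (q * (identity i · x) + 1ℤ * (ones · x)) + (- 1ℤ) * (A i · x)
        ≡⟨ cong₂ (λ u v → 1ℤ * (q * u + 1ℤ * v) + (- 1ℤ) * (A i · x)) (·-identity i x) (ones-· x) ⟩
      1ℤ * (q * x i + 1ℤ * ∑ x) + (- 1ℤ) * (A i · x)    ≡⟨ tidy q (x i) (∑ x) (A i · x) ⟩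
      q * x i + ∑ x - A i · x                           ∎
      where
      tidy : ∀ q x σ a → 1ℤ * (q * x + 1ℤ * σ) + (- 1ℤ) * a ≡ q * x + σ - a
      tidy = solve-∀
      swap : ∀ q e b → b ≡ 1ℤ * (q * e + 1ℤ * 1ℤ) + (- 1ℤ) * (q * e + 1ℤ - b)
      swap = solve-∀
      entry : ∀ k → M i · M k ≡ 1ℤ * (q * identity i k + 1ℤ * 1ℤ) + (- 1ℤ) * A i k
      entry k = trans (swap q (identity i k) (M i · M k))
        (cong (λ u → 1ℤ * (q * identity i k + 1ℤ * 1ℤ) + (- 1ℤ) * u) (sym (skewness i k)))

    A-formula : ∀ x i → (A ∙ x) i ≡ q * x i + ∑ x - (M ∙ (Mᵀ ∙ x)) i
    A-formula x i = trans (swap (q * x i + ∑ x) ((A ∙ x) i)) (cong (λ u → q * x i + ∑ x - u) (sym (MMᵀ x i)))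
      where
      swap : ∀ b a → a ≡ b - (b - a)
      swap = solve-∀

    -- Geometrically: of the q² + q + 1 lines through a point off the line `i`, q + 1 meet it and q²
    -- are skew to it; of those through a point on it, none is.
    AM : ∀ y i → (A ∙ (M ∙ y)) i ≡ q * q * (∑ y - (M ∙ y) i)
    AM y i = begin
      (A ∙ (M ∙ y)) i
        ≡⟨ A-formula (M ∙ y) i ⟩
      q * (M ∙ y) i + ∑ (M ∙ y) - M i · (Mᵀ ∙ (M ∙ y))
        ≡⟨ cong₂ (λ u v → q * (M ∙ y) i + u - v) (∑-M y) MMᵀMy ⟩
      q * (M ∙ y) i + (q * q + q + 1ℤ) * ∑ y - ((q * q + q) * (M ∙ y) i + ∑ y * (q + 1ℤ))
        ≡⟨ tidy q ((M ∙ y) i) (∑ y) ⟩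
      q * q * (∑ y - (M ∙ y) i) ∎
      where
      tidy : ∀ q z σ → q * z + (q * q + q + 1ℤ) * σ - ((q * q + q) * z + σ * (q + 1ℤ)) ≡ q * q * (σ - z)
      tidy = solve-∀
      MMᵀMy : M i · (Mᵀ ∙ (M ∙ y)) ≡ (q * q + q) * (M ∙ y) i + ∑ y * (q + 1ℤ)
      MMᵀMy = begin
        M i · (Mᵀ ∙ (M ∙ y))                      ≡⟨ ·-congʳ (M i) (MᵀM y) ⟩
        M i · (λ r → (q * q + q) * y r + ∑ y)     ≡⟨ ·-+ (M i) (λ r → (q * q + q) * y r) (λ _ → ∑ y) ⟩
        M i · (λ r → (q * q + q) * y r) + M i · (λ _ → ∑ y)
          ≡⟨ cong₂ _+_ (·-scale (M i) (q * q + q) y) (M-const (∑ y) i) ⟩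
        (q * q + q) * (M ∙ y) i + ∑ y * (q + 1ℤ)  ∎

    A-ones : ∀ i → (A ∙ ones) i ≡ q * q * q * q
    A-ones i = begin
      (A ∙ ones) i                                       ≡⟨ A-formula ones i ⟩
      q * 1ℤ + ∑ {N} ones - M i · (Mᵀ ∙ ones)
        ≡⟨ cong₂ (λ u v → q * 1ℤ + u - v) (trans (∑-ones N) lines)
             (trans (·-congʳ (M i) (λ r → trans (·-ones (Mᵀ r)) (degree r))) (M-const (q * q + q + 1ℤ) i)) ⟩
      q * 1ℤ + (q * q + 1ℤ) * (q * q + q + 1ℤ) - (q * q + q + 1ℤ) * (q + 1ℤ)  ≡⟨ tidy q ⟩
      q * q * q * q                                      ∎
      where
      tidy : ∀ q → q * 1ℤ + (q * q + 1ℤ) * (q * q + q + 1ℤ) - (q * q + q + 1ℤ) * (q + 1ℤ) ≡ q * q * q * q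
      tidy = solve-∀

    -- Only the inner factor is expanded as qI + J - M Mᵀ; what remains is `A` itself, `A-ones` and
    -- `AM`.
    AA : ∀ x i → (A ∙ (A ∙ x)) i ≡ (q - q * q) * (A ∙ x) i + q * q * q * (x i + (q - 1ℤ) * ∑ x)
    AA x i = begin
      A i · (A ∙ x)
        ≡⟨ ·-congʳ (A i) (λ k → trans (A-formula x k) (regroup q (x k) (∑ x) ((M ∙ (Mᵀ ∙ x)) k))) ⟩
      A i · (λ k → 1ℤ * (q * x k + ∑ x * 1ℤ) + (- 1ℤ) * (M ∙ (Mᵀ ∙ x)) k)
        ≡⟨ ·-linear (A i) 1ℤ (- 1ℤ) (λ k → q * x k + ∑ x * 1ℤ) (M ∙ (Mᵀ ∙ x)) ⟩
      1ℤ * (A i · (λ k → q * x k + ∑ x * 1ℤ)) + (- 1ℤ) * (A i · (M ∙ (Mᵀ ∙ x)))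
        ≡⟨ cong₂ (λ u v → 1ℤ * u + (- 1ℤ) * v) (·-linear (A i) q (∑ x) x ones) (AM (Mᵀ ∙ x) i) ⟩
      1ℤ * (q * (A i · x) + ∑ x * (A i · ones)) + (- 1ℤ) * (q * q * (∑ (Mᵀ ∙ x) - (M ∙ (Mᵀ ∙ x)) i))
        ≡⟨ cong₂ (λ u v → 1ℤ * (q * (A i · x) + ∑ x * u) + (- 1ℤ) * (q * q * v)) (A-ones i)
             (cong₂ _-_ (∑-Mᵀ x) (MMᵀ x i)) ⟩
      1ℤ * (q * (A i · x) + ∑ x * (q * q * q * q)) + (- 1ℤ) * (q * q * ((q + 1ℤ) * ∑ x - (q * x i + ∑ x - A i · x)))
        ≡⟨ tidy q (x i) (∑ x) (A i · x) ⟩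
      (q - q * q) * (A i · x) + q * q * q * (x i + (q - 1ℤ) * ∑ x) ∎
      where
      regroup : ∀ q x σ z → q * x + σ - z ≡ 1ℤ * (q * x + σ * 1ℤ) + (- 1ℤ) * z
      regroup = solve-∀
      tidy : ∀ q x σ a → 1ℤ * (q * a + σ * (q * q * q * q)) + (- 1ℤ) * (q * q * ((q + 1ℤ) * σ - (q * x + σ - a)))
                         ≡ (q - q * q) * a + q * q * q * (x + (q - 1ℤ) * σ)
      tidy = solve-∀

    ∑-A : ∀ x → ∑ (A ∙ x) ≡ q * q * q * q * ∑ x
    ∑-A x = begin
      ∑ (A ∙ x)
        ≡⟨ ∑-cong (λ k → trans (A-formula x k) (regroup q (x k) (∑ x) ((M ∙ (Mᵀ ∙ x)) k))) ⟩
      ∑ (λ k → 1ℤ * (q * x k + ∑ x * 1ℤ) + (- 1ℤ) * (M ∙ (Mᵀ ∙ x)) k)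
        ≡⟨ ∑-linear 1ℤ (- 1ℤ) (λ k → q * x k + ∑ x * 1ℤ) (M ∙ (Mᵀ ∙ x)) ⟩
      1ℤ * ∑ (λ k → q * x k + ∑ x * 1ℤ) + (- 1ℤ) * ∑ (M ∙ (Mᵀ ∙ x))
        ≡⟨ cong₂ (λ u v → 1ℤ * u + (- 1ℤ) * v) (∑-linear q (∑ x) x ones) (trans (∑-M (Mᵀ ∙ x)) (cong ((q * q + q + 1ℤ) *_) (∑-Mᵀ x))) ⟩
      1ℤ * (q * ∑ x + ∑ x * ∑ {N} ones) + (- 1ℤ) * ((q * q + q + 1ℤ) * ((q + 1ℤ) * ∑ x))
        ≡⟨ cong (λ u → 1ℤ * (q * ∑ x + ∑ x * u) + (- 1ℤ) * ((q * q + q + 1ℤ) * ((q + 1ℤ) * ∑ x))) (trans (∑-ones N) lines) ⟩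
      1ℤ * (q * ∑ x + ∑ x * ((q * q + 1ℤ) * (q * q + q + 1ℤ))) + (- 1ℤ) * ((q * q + q + 1ℤ) * ((q + 1ℤ) * ∑ x))
        ≡⟨ tidy q (∑ x) ⟩
      q * q * q * q * ∑ x ∎
      where
      regroup : ∀ q x σ z → q * x + σ - z ≡ 1ℤ * (q * x + σ * 1ℤ) + (- 1ℤ) * z
      regroup = solve-∀
      tidy : ∀ q σ → 1ℤ * (q * σ + σ * ((q * q + 1ℤ) * (q * q + q + 1ℤ))) + (- 1ℤ) * ((q * q + q + 1ℤ) * ((q + 1ℤ) * σ))
                     ≡ q * q * q * q * σ
      tidy = solve-∀

    -- q⁴ A⁻¹ is integral: in q A (A + q² - q) = q⁴ (I + (q - 1) J) the last term is (q - 1) J A,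
    -- because the columns of A sum to q⁴. So q⁴ x is an integer combination of the entries of A x.
    ∣A⇒∣q⁴ : ∀ {k x} → (∀ i → k ∣ (A ∙ x) i) → ∀ i → k ∣ q * q * q * q * x i
    ∣A⇒∣q⁴ {k} {x} k∣Ax i = subst (k ∣_) eq
      (∣m∣n⇒∣m+n (∣n⇒∣m*n q (∣m∣n⇒∣m+n (∣-· (A i) k∣Ax) (∣n⇒∣m*n (q * q - q) (k∣Ax i))))
                 (∣n⇒∣m*n (1ℤ - q) (∣-∑ k∣Ax)))
      where
      tidy : ∀ q a x σ → q * ((q - q * q) * a + q * q * q * (x + (q - 1ℤ) * σ) + (q * q - q) * a) + (1ℤ - q) * (q * q * q * q * σ)
                         ≡ q * q * q * q * x
      tidy = solve-∀
      eq : q * (A i · (A ∙ x) + (q * q - q) * (A ∙ x) i) + (1ℤ - q) * ∑ (A ∙ x) ≡ q * q * q * q * x i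
      eq = trans (cong₂ (λ u v → q * (u + (q * q - q) * (A ∙ x) i) + (1ℤ - q) * v) (AA x i) (∑-A x))
                 (tidy q ((A ∙ x) i) (x i) (∑ x))

    -- Summing over the lines first gives sum 0 for `y`; on such vectors MᵀM is multiplication by q²
    -- + q, which is nonzero.
    M-injective : ∀ y → (∀ i → (M ∙ y) i ≡ 0ℤ) → ∀ r → y r ≡ 0ℤ
    M-injective y My≡0 r = *-cancelˡ-≡ (q * q + q) _ _ (begin
      (q * q + q) * y r           ≡⟨ +-identityʳ _ ⟨
      (q * q + q) * y r + 0ℤ      ≡⟨ cong (λ u → (q * q + q) * y r + u) σ≡0 ⟨
      (q * q + q) * y r + ∑ y     ≡⟨ MᵀM y r ⟨
      Mᵀ r · (M ∙ y)              ≡⟨ ·-zero (Mᵀ r) My≡0 ⟩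
      0ℤ                          ≡⟨ *-zeroʳ (q * q + q) ⟨
      (q * q + q) * 0ℤ            ∎)
      where
      σ≡0 : ∑ y ≡ 0ℤ
      σ≡0 = *-cancelˡ-≡ (q * q + q + 1ℤ) _ _
        (trans (sym (∑-M y)) (trans (∑-zero (M ∙ y) My≡0) (sym (*-zeroʳ (q * q + q + 1ℤ)))))

-- Divisors of a prime power

module PrimePower where

  open ≡

  open import Data.Nat.Divisibility using (_∣_; divides; _∣?_; ∣1⇒≡1; *-cancelˡ-∣)

  -- A factor `p` of `d` is cancelled against one of the power; if there is none, `d` is coprime to
  -- `p` and already divides the next smaller power.
  divisor-of-power : ∀ {p} → Prime p → ∀ k {d} → d ∣ p ℕ.^ k → ∃[ a ] a ℕ.≤ k × d ≡ p ℕ.^ a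
  divisor-of-power {p} pr zero    d∣1 = 0 , ℕ.z≤n , ∣1⇒≡1 d∣1
  divisor-of-power {p} pr (suc k) {d} d∣ with p ∣? d
  ... | no p∤d with divisor-of-power pr k (coprime-divisor d⊥p d∣)
    where
    d⊥p : Coprime d p
    d⊥p (e∣d , e∣p) with prime⇒irreducible pr e∣p
    ... | inj₁ e≡1  = e≡1
    ... | inj₂ refl = contradiction e∣d p∤d
  ...   | a , a≤k , eq = a , ℕ.m≤n⇒m≤1+n a≤k , eq
  divisor-of-power {p} pr (suc k) {d} d∣ | yes (divides d′ refl)
    with divisor-of-power pr k (*-cancelˡ-∣ p {{prime⇒nonZero pr}} (subst (_∣ p ℕ.^ suc k) (ℕ.*-comm d′ p) d∣))
  ... | a , a≤k , eq = suc a , ℕ.s≤s a≤k , trans (ℕ.*-comm d′ p) (cong (p ℕ.*_) eq)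

-- The elementary divisors as powers of p

module Exponents where

  open ≡

  open import Data.Integer.Base as ℤ using (+_; _+_; _*_; _-_)
  open import Data.Integer.Properties
  open import Data.Integer.Divisibility.Signed
  open import Data.Integer.Tactic.RingSolver using (solve-∀)
  open LinearForms
  open Counting
  open SmithForm
  open LineSpace
  open ≡-Reasoning

  module _ {n N m : ℕ} {A : Matrix N} {M : Fin N → Fin m → ℤ} (G : SkewnessData n N m A M)
           (snf : SmithNormalForm A) (p t : ℕ) (pr : Prime p) (pᵗ≡q : p ℕ.^ t ≡ suc n) where

    open SkewnessData G using (q)
    open Identities G using (∣A⇒∣q⁴)
    open Transforms A snf using (d; P⁻¹; Q; Q⁻¹; Q⁻¹Q; AQ)

    -- For the unit vector `e` at `j`, A Q e = P⁻¹ D e is divisible by `d j`, hence so is q⁴ Q e;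
    -- applying Q⁻¹ leaves q⁴ in the coordinate `j`.
    d∣q⁴ : ∀ j → + d j ∣ q * q * q * q
    d∣q⁴ j = subst (+ d j ∣_) eq (∣-· (Q⁻¹ j) (∣A⇒∣q⁴ d∣AQe))
      where
      e : Fin N → ℤ
      e k = identity j k
      d∣de : ∀ k → + d j ∣ + d k * e k
      d∣de k with j Fin.≟ k
      ... | yes refl = ∣m⇒∣m*n 1ℤ ∣-refl
      ... | no _     = divides 0ℤ (*-zeroʳ (+ d k))
      d∣AQe : ∀ i → + d j ∣ (A ∙ (Q ∙ e)) i
      d∣AQe i = subst (+ d j ∣_) (sym (AQ e i)) (∣-· (P⁻¹ i) d∣de)
      eⱼ≡1 : e j ≡ 1ℤ
      eⱼ≡1 with j Fin.≟ j
      ... | yes _  = refl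
      ... | no j≢j = contradiction refl j≢j
      eq : Q⁻¹ j · (λ i → q * q * q * q * (Q ∙ e) i) ≡ q * q * q * q
      eq = trans (·-scale (Q⁻¹ j) (q * q * q * q) (Q ∙ e))
             (trans (cong (q * q * q * q *_) (trans (Q⁻¹Q e j) eⱼ≡1)) (*-identityʳ _))

    q⁴≡p⁴ᵗ : q * q * q * q ≡ + (p ℕ.^ (4 ℕ.* t))
    q⁴≡p⁴ᵗ = begin
      q * q * q * q                      ≡⟨ cong (λ u → + u * + u * + u * + u) pᵗ≡q ⟨
      + u * + u * + u * + u              ≡⟨ tidy (+ u) ⟩
      + u * (+ u * (+ u * (+ u * 1ℤ)))   ≡⟨ cong (λ v → + u * (+ u * v)) (trans (cong (+ u *_) (sym (pos-* u 1))) (sym (pos-* u (u ℕ.* 1)))) ⟩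
      + u * (+ u * + (u ℕ.* (u ℕ.* 1)))  ≡⟨ trans (cong (+ u *_) (sym (pos-* u (u ℕ.* (u ℕ.* 1))))) (sym (pos-* u (u ℕ.* (u ℕ.* (u ℕ.* 1))))) ⟩
      + (u ℕ.^ 4)                        ≡⟨ cong +_ (trans (ℕ.^-*-assoc p t 4) (cong (p ℕ.^_) (ℕ.*-comm t 4))) ⟩
      + (p ℕ.^ (4 ℕ.* t))                ∎
      where
      u = p ℕ.^ t
      tidy : ∀ u → u * u * u * u ≡ u * (u * (u * (u * 1ℤ)))
      tidy = solve-∀

    exponent : ∀ j → ∃[ a ] a ℕ.≤ 4 ℕ.* t × d j ≡ p ℕ.^ a
    exponent j = PrimePower.divisor-of-power pr (4 ℕ.* t)
      (∣⇒∣ᵤ (subst (+ d j ∣_) q⁴≡p⁴ᵗ (d∣q⁴ j)))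

  -- Bounds on the number of exponents in each range

  module Claims {n N m : ℕ} {A : Matrix N} {M : Fin N → Fin m → ℤ} (G : SkewnessData n N m A M)
                (snf : SmithNormalForm A) {p t : ℕ} (1<p : 1 ℕ.< p) (0<t : 0 ℕ.< t)
                (pᵗ≡q : p ℕ.^ t ≡ suc n) (a : Fin N → ℕ)
                (d≡pᵃ : ∀ j → SmithNormalForm.d snf j ≡ p ℕ.^ a j) where

    open SkewnessData G using (q; line-size)
    open Identities G
    open Transforms A snf
    open Powers p 1<p
    open Bounds A snf a d≡pᵃ

    q≡pow : q ≡ pow t
    q≡pow = cong +_ (sym pᵗ≡q)

    p∣q : + p ∣ q
    p∣q = subst (+ p ∣_) (sym q≡pow) (p∣pow 0<t)

    q²≡pow : q * q ≡ pow (t ℕ.+ t)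
    q²≡pow = trans (cong₂ _*_ q≡pow q≡pow) (sym (pow-+ t t))

    q⁴≡pow : q * q * q * q ≡ pow (t ℕ.+ t ℕ.+ (t ℕ.+ t))
    q⁴≡pow = trans (*-assoc (q * q) q q) (trans (cong₂ _*_ q²≡pow q²≡pow) (sym (pow-+ (t ℕ.+ t) (t ℕ.+ t))))

    -- (q² + 1)(q² + q + 1) is 1 modulo q, and `p` divides q.
    p∣Nx⇒p∣x : ∀ {x} → + p ∣ + N * x → + p ∣ x
    p∣Nx⇒p∣x {x} p∣Nx = ∣m+n∣m⇒∣n (subst (+ p ∣_) (trans (cong (_* x) lines) (expand q x)) p∣Nx)
                                  (∣m⇒∣m*n ((q * q * q + q * q + q + q + 1ℤ) * x) p∣q)
      where
      expand : ∀ q x → (q * q + 1ℤ) * (q * q + q + 1ℤ) * x ≡ q * ((q * q * q + q * q + q + q + 1ℤ) * x) + x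
      expand = solve-∀

    N≤below[1+t]+m : N ℕ.≤ below a (suc t) ℕ.+ m
    N≤below[1+t]+m = subst (λ u → N ℕ.≤ below a (suc t) ℕ.+ u) (List.length-tabulate Mᵀ)
      (above-≤ (suc t) (List.tabulate Mᵀ) killed⇒p∣)
      where
      killed⇒p∣ : ∀ x → All (Kills x) (List.tabulate Mᵀ) → (∀ i → pow (suc t) ∣ (A ∙ x) i) → ∀ i → + p ∣ x i
      -- Here `A ∙ x` is `p ^ t` times `x`, so one factor of `p ^ suc t` falls to `x i`.
      killed⇒p∣ x killed p∣Ax i = pow-cancel-∣ (ℕ.n<1+n t) (subst (pow (suc t) ∣_) Ax≡qx (p∣Ax i))
        where
        Mᵀx≡0 : ∀ r → (Mᵀ ∙ x) r ≡ 0ℤ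
        Mᵀx≡0 = All.tabulate⁻ killed
        σ≡0 : ∑ x ≡ 0ℤ
        σ≡0 = *-cancelˡ-≡ (q + 1ℤ) _ _
          (trans (sym (∑-Mᵀ x)) (trans (∑-zero (Mᵀ ∙ x) Mᵀx≡0) (sym (*-zeroʳ (q + 1ℤ)))))
        tidy : ∀ u → u + 0ℤ - 0ℤ ≡ u
        tidy = solve-∀
        Ax≡qx : (A ∙ x) i ≡ pow t * x i
        Ax≡qx = begin
          (A ∙ x) i                                ≡⟨ A-formula x i ⟩
          q * x i + ∑ x - (M ∙ (Mᵀ ∙ x)) i         ≡⟨ cong₂ (λ u v → q * x i + u - v) σ≡0 (·-zero (M i) Mᵀx≡0) ⟩
          q * x i + 0ℤ - 0ℤ                        ≡⟨ tidy (q * x i) ⟩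
          q * x i                                  ≡⟨ cong (_* x i) q≡pow ⟩
          pow t * x i                              ∎

    below[2t]+m≤N : below a (t ℕ.+ t) ℕ.+ m ℕ.≤ N
    below[2t]+m≤N = subst (below a (t ℕ.+ t) ℕ.+ m ℕ.≤_) (ℕ.+-identityʳ N) (below-≤ (t ℕ.+ t) m [] M (λ x x≢0 _ → multiple x x≢0))
      where
      -- For `M ∙ x` equal to `pow l` times `y`, `AM` gives q² (∑ x - M x), but ∑ x need not be
      -- divisible by `pow l`. Multiplication by `c` repairs this: c ∑ x is the sum of M x, hence
      -- `pow l` times ∑ y. Since `c` is 1 modulo p, the vector c y is still primitive.
      c = q * q + q + 1ℤ
      multiple : ∀ x → Nonzero x → PrimitiveMultiple (t ℕ.+ t) (M ∙ x)
      multiple x (r , xᵣ≢0) with Fin.any? (λ i → ¬? ((M ∙ x) i ≟ 0ℤ))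
      ... | no ¬∃ = contradiction
        (M-injective x (λ i → decidable-stable ((M ∙ x) i ≟ 0ℤ) (λ Mx≢0 → ¬∃ (i , Mx≢0))) r) xᵣ≢0
      ... | yes Mx≢0 with primitivePart (M ∙ x) Mx≢0
      ...   | l , y , Mx≡ , y-prim = record
        { r = c ; s = pow l ; s≢0 = pow≢0 l ; y = λ i → c * y i
        ; sy≡rx       = λ i → trans (swap (pow l) c (y i)) (cong (c *_) (sym (Mx≡ i)))
        ; primitive-y = λ p∣cy → y-prim (λ i → ∣m+n∣m⇒∣n (subst (+ p ∣_) (expand q (y i)) (p∣cy i))
                                                        (∣m⇒∣m*n ((q + 1ℤ) * y i) p∣q))
        ; pᵏ∣Ay       = λ i → subst₂ _∣_ q²≡pow (sym (Acy i)) (∣m⇒∣m*n (∑ y - c * y i) ∣-refl)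
        }
        where
        swap : ∀ s c y → s * (c * y) ≡ c * (s * y)
        swap = solve-∀
        expand : ∀ q y → (q * q + q + 1ℤ) * y ≡ q * ((q + 1ℤ) * y) + y
        expand = solve-∀
        cσ : c * ∑ x ≡ pow l * ∑ y
        cσ = trans (sym (∑-M x)) (trans (∑-cong Mx≡) (∑-*ˡ (pow l) y))
        pull : ∀ c u σ z → c * (u * (σ - z)) ≡ u * (c * σ - c * z)
        pull = solve-∀
        factor : ∀ u s σ c y → u * (s * σ - c * (s * y)) ≡ s * (u * (σ - c * y))
        factor = solve-∀
        Acy : ∀ i → A i · (λ k → c * y k) ≡ q * q * (∑ y - c * y i)
        Acy i = *-cancelˡ-≡ (pow l) _ _ {{pow-nonZero l}} (begin
          pow l * (A i · (λ k → c * y k))         ≡⟨ cong (pow l *_) (·-scale (A i) c y) ⟩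
          pow l * (c * (A i · y))                 ≡⟨ swap (pow l) c (A i · y) ⟩
          c * (pow l * (A i · y))                 ≡⟨ cong (c *_) (·-scale (A i) (pow l) y) ⟨
          c * (A i · (λ k → pow l * y k))         ≡⟨ cong (c *_) (·-congʳ (A i) Mx≡) ⟨
          c * (A i · (M ∙ x))                     ≡⟨ cong (c *_) (AM x i) ⟩
          c * (q * q * (∑ x - (M ∙ x) i))         ≡⟨ pull c (q * q) (∑ x) ((M ∙ x) i) ⟩
          q * q * (c * ∑ x - c * (M ∙ x) i)       ≡⟨ cong₂ (λ u v → q * q * (u - c * v)) cσ (Mx≡ i) ⟩
          q * q * (pow l * ∑ y - c * (pow l * y i))  ≡⟨ factor (q * q) (pow l) (∑ y) c (y i) ⟩
          pow l * (q * q * (∑ y - c * y i))       ∎)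

    below[4t]+1≤N : below a (t ℕ.+ t ℕ.+ (t ℕ.+ t)) ℕ.+ 1 ℕ.≤ N
    below[4t]+1≤N = subst (below a (t ℕ.+ t ℕ.+ (t ℕ.+ t)) ℕ.+ 1 ℕ.≤_) (ℕ.+-identityʳ N)
      (below-≤ (t ℕ.+ t ℕ.+ (t ℕ.+ t)) 1 [] (λ _ _ → 1ℤ) (λ { x (zero , x≢0) _ → record
        { r = 1ℤ ; s = x zero ; s≢0 = x≢0 ; y = ones
        ; sy≡rx       = λ i → trans (*-identityʳ (x zero)) (sym (trans (*-identityˡ _)
                                (trans (·-suc (λ _ → 1ℤ) x) (trans (cong₂ _+_ (*-identityˡ (x zero)) (·-zero {0} (λ _ → 1ℤ) (λ ()))) (+-identityʳ (x zero))))))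
        -- Summing the coordinates gives p ∣ N without the choice of an index, and N ≡ 1 modulo p.
        ; primitive-y = λ p∣1 → p∤1 (p∣Nx⇒p∣x (subst (+ p ∣_) (trans (∑-ones N) (sym (*-identityʳ (+ N)))) (∣-∑ p∣1)))
        ; pᵏ∣Ay       = λ i → subst₂ _∣_ q⁴≡pow (sym (A-ones i)) ∣-refl
        } }))
      where
      p∤1 : ¬ (+ p ∣ 1ℤ)
      p∤1 p∣1 = ℕ.<-irrefl (sym (ℕ.∣1⇒≡1 (∣⇒∣ᵤ p∣1))) 1<p

    -- The next two bounds together say that the exponents at least K = 2t + s = 3t + 1 - k
    -- outnumber those less than `k` by exactly one: they are the partners 3t - a of the latter, and
    -- 4t. The parameter `s` replaces a truncated subtraction.
    module _ {k s : ℕ} (k+s≡1+t : k ℕ.+ s ≡ suc t) (0<s : 0 ℕ.< s) where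

      private
        k≤t : k ℕ.≤ t
        k≤t = ℕ.s≤s⁻¹ (subst (k ℕ.<_) k+s≡1+t (ℕ.m<m+n k 0<s))

        s≤1+t : s ℕ.≤ suc t
        s≤1+t = subst (s ℕ.≤_) k+s≡1+t (ℕ.m≤n+m s k)

        K : ℕ
        K = t ℕ.+ t ℕ.+ s

        powK : pow K ≡ q * q * pow s
        powK = trans (pow-+ (t ℕ.+ t) s) (cong (_* pow s) (sym q²≡pow))

        -- `s` is at most t + 1, which is at most 2t because t ≥ 1; so the all-ones vector is
        -- annihilated modulo p^K as well.
        powK∣q⁴ : pow K ∣ q * q * q * q
        powK∣q⁴ = subst (pow K ∣_) (sym q⁴≡pow)
          (pow-mono-∣ (ℕ.+-monoʳ-≤ (t ℕ.+ t) (ℕ.≤-trans s≤1+t (ℕ.+-monoˡ-≤ t 0<t))))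

      -- A annihilates modulo p^K the vectors u_j = P⁻¹e_j + (q - 1) w_j, where
      -- q u_j = (A + q² - q) w_j and w_j = p^(t - a_j) Q e_j, for a_j < k, and also the
      -- all-ones vector; together they are independent modulo p.
      complementary-≤ : below a K ℕ.+ below a k ℕ.+ 1 ℕ.≤ N
      complementary-≤ = ℕ.+-cancelʳ-≤ (above a k) _ _ (subst₂ ℕ._≤_ count-lhs count-rhs (below-≤ K (suc N) ws M′ multiple))
        where
        -- The columns with `k ≤ a j` stay in the family; `ws` forces their coefficients to vanish,
        -- and `above a k` is then cancelled from both sides of the bound.
        ws : List (Fin (suc N) → ℤ)
        ws = map (λ j → identity (suc j)) (indices (k ℕ.≤?_) a)
        M′ : Fin N → Fin (suc N) → ℤ
        M′ i zero    = 1ℤ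
        -- For `a j < k ≤ t` the power completes `d j` to q. Truncation in `t ∸ a j` occurs only in
        -- columns whose coefficient `ws` forces to 0.
        M′ i (suc j) = 1ℤ * P⁻¹ i j + (q - 1ℤ) * (Q i j * pow (t ℕ.∸ a j))
        count-rhs : N ℕ.+ length ws ≡ N ℕ.+ above a k
        count-rhs = cong (N ℕ.+_) (trans (List.length-map _ (indices (k ℕ.≤?_) a)) (length-indices (k ℕ.≤?_) a))
        count-lhs : below a K ℕ.+ suc N ≡ below a K ℕ.+ below a k ℕ.+ 1 ℕ.+ above a k
        count-lhs = trans (cong (λ u → below a K ℕ.+ suc u) (sym (below+above a k)))
          (shuffle (below a K) (below a k) (above a k))
          where
          open import Data.Nat.Tactic.RingSolver using () renaming (solve-∀ to solveℕ)
          shuffle : ∀ x y z → x ℕ.+ suc (y ℕ.+ z) ≡ x ℕ.+ y ℕ.+ 1 ℕ.+ z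
          shuffle = solveℕ

        multiple : ∀ x → Nonzero x → All (Kills x) ws → PrimitiveMultiple K (M′ ∙ x)
        multiple x₁ x₁≢0 killed with primitivePart x₁ x₁≢0
        ... | l , x , x₁≡ , x-prim = record
          { r = 1ℤ ; s = pow l ; s≢0 = pow≢0 l ; y = M′ ∙ x
          ; sy≡rx       = λ i → trans (sym (·-scale (M′ i) (pow l) x))
                                 (trans (·-congʳ (M′ i) (λ c → sym (x₁≡ c))) (sym (*-identityˡ _)))
          ; primitive-y = λ p∣y → x-prim (p∣x p∣y)
          ; pᵏ∣Ay       = λ i → subst (pow K ∣_) (sym (Ay i))
                             (∣m∣n⇒∣m+n (∣n⇒∣m*n (x zero) powK∣q⁴) (powK∣Au i))
          }
          where
          z z′ : Fin N → ℤ
          z j  = x (suc j)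
          z′ j = pow (t ℕ.∸ a j) * z j
          w u : Fin N → ℤ
          w = Q ∙ z′
          u i = 1ℤ * (P⁻¹ ∙ z) i + (q - 1ℤ) * w i

          z≡0 : ∀ j → k ℕ.≤ a j → z j ≡ 0ℤ
          z≡0 j k≤aⱼ with i*j≡0⇒i≡0∨j≡0 (pow l) (trans (sym (x₁≡ (suc j)))
            (trans (sym (·-identity (suc j) x₁)) (All-indices (k ℕ.≤?_) a (λ j → identity (suc j)) killed j k≤aⱼ)))
          ... | inj₁ pˡ≡0 = contradiction pˡ≡0 (pow≢0 l)
          ... | inj₂ eq   = eq

          dz′≡qz : ∀ j → + d j * z′ j ≡ q * z j
          dz′≡qz j with a j ℕ.<? k
          ... | yes aⱼ<k = begin
            + d j * (pow (t ℕ.∸ a j) * z j)       ≡⟨ *-assoc (+ d j) _ (z j) ⟨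
            + d j * pow (t ℕ.∸ a j) * z j         ≡⟨ cong (λ v → v * pow (t ℕ.∸ a j) * z j) (pow-a j) ⟩
            pow (a j) * pow (t ℕ.∸ a j) * z j     ≡⟨ cong (_* z j) (pow-+ (a j) (t ℕ.∸ a j)) ⟨
            pow (a j ℕ.+ (t ℕ.∸ a j)) * z j
              ≡⟨ cong (λ v → pow v * z j) (ℕ.m+[n∸m]≡n (ℕ.≤-trans (ℕ.<⇒≤ aⱼ<k) k≤t)) ⟩
            pow t * z j                           ≡⟨ cong (_* z j) q≡pow ⟨
            q * z j                               ∎
          ... | no aⱼ≮k = begin
            + d j * (pow (t ℕ.∸ a j) * z j)
              ≡⟨ cong (λ v → + d j * (pow (t ℕ.∸ a j) * v)) (z≡0 j (ℕ.≮⇒≥ aⱼ≮k)) ⟩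
            + d j * (pow (t ℕ.∸ a j) * 0ℤ)        ≡⟨ vanish (+ d j) (pow (t ℕ.∸ a j)) q ⟩
            q * 0ℤ                                ≡⟨ cong (q *_) (z≡0 j (ℕ.≮⇒≥ aⱼ≮k)) ⟨
            q * z j                               ∎
            where
            vanish : ∀ d b q → d * (b * 0ℤ) ≡ q * 0ℤ
            vanish = solve-∀

          Aw : ∀ i → (A ∙ w) i ≡ q * (P⁻¹ ∙ z) i
          Aw i = trans (AQ z′ i) (trans (·-congʳ (P⁻¹ i) dz′≡qz) (·-scale (P⁻¹ i) q z))

          qu : ∀ i → q * u i ≡ 1ℤ * (A ∙ w) i + (q * q - q) * w i
          qu i = trans (expand q ((P⁻¹ ∙ z) i) (w i)) (cong (λ v → 1ℤ * v + (q * q - q) * w i) (sym (Aw i)))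
            where
            expand : ∀ q v w → q * (1ℤ * v + (q - 1ℤ) * w) ≡ 1ℤ * (q * v) + (q * q - q) * w
            expand = solve-∀

          -- A (A + q² - q) w carries the factor q³, of which the division by q in the definition of
          -- `u` takes one. The q² left and the `p ^ s` that divides `w` make up p^K.
          Au : ∀ i → (A ∙ u) i ≡ q * q * (w i + (q - 1ℤ) * ∑ w)
          Au i = *-cancelˡ-≡ q _ _ (begin
            q * (A i · u)                                          ≡⟨ ·-scale (A i) q u ⟨
            A i · (λ c → q * u c)                                  ≡⟨ ·-congʳ (A i) qu ⟩
            A i · (λ c → 1ℤ * (A ∙ w) c + (q * q - q) * w c)       ≡⟨ ·-linear (A i) 1ℤ (q * q - q) (A ∙ w) w ⟩
            1ℤ * (A i · (A ∙ w)) + (q * q - q) * (A i · w)         ≡⟨ cong (λ v → 1ℤ * v + (q * q - q) * (A i · w)) (AA w i) ⟩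
            1ℤ * ((q - q * q) * (A i · w) + q * q * q * (w i + (q - 1ℤ) * ∑ w)) + (q * q - q) * (A i · w)
              ≡⟨ tidy q (A i · w) (w i + (q - 1ℤ) * ∑ w) ⟩
            q * (q * q * (w i + (q - 1ℤ) * ∑ w))                   ∎)
            where
            tidy : ∀ q a b → 1ℤ * ((q - q * q) * a + q * q * q * b) + (q * q - q) * a ≡ q * (q * q * b)
            tidy = solve-∀

          ∑u : ∑ u ≡ (q * q * q + q - 1ℤ) * ∑ w
          ∑u = *-cancelˡ-≡ q _ _ (begin
            q * ∑ u                                            ≡⟨ ∑-*ˡ q u ⟨
            ∑ (λ i → q * u i)                                  ≡⟨ ∑-cong qu ⟩
            ∑ (λ i → 1ℤ * (A ∙ w) i + (q * q - q) * w i)       ≡⟨ ∑-linear 1ℤ (q * q - q) (A ∙ w) w ⟩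
            1ℤ * ∑ (A ∙ w) + (q * q - q) * ∑ w                 ≡⟨ cong (λ v → 1ℤ * v + (q * q - q) * ∑ w) (∑-A w) ⟩
            1ℤ * (q * q * q * q * ∑ w) + (q * q - q) * ∑ w     ≡⟨ tidy q (∑ w) ⟩
            q * ((q * q * q + q - 1ℤ) * ∑ w)                   ∎)
            where
            tidy : ∀ q σ → 1ℤ * (q * q * q * q * σ) + (q * q - q) * σ ≡ q * ((q * q * q + q - 1ℤ) * σ)
            tidy = solve-∀

          -- From `a j < k` follows a j + s < k + s = t + 1, that is `s ≤ t ∸ a j`.
          pˢ∣z′ : ∀ j → pow s ∣ z′ j
          pˢ∣z′ j with a j ℕ.<? k
          ... | yes aⱼ<k = ∣m⇒∣m*n (z j) (pow-mono-∣
            (ℕ.m+n≤o⇒m≤o∸n s (subst (ℕ._≤ t) (ℕ.+-comm (a j) s) (ℕ.s≤s⁻¹ (subst (suc (a j ℕ.+ s) ℕ.≤_) k+s≡1+t (ℕ.+-monoˡ-≤ s aⱼ<k))))))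
          ... | no  aⱼ≮k = divides 0ℤ (trans (cong (pow (t ℕ.∸ a j) *_) (z≡0 j (ℕ.≮⇒≥ aⱼ≮k))) (*-zeroʳ (pow (t ℕ.∸ a j))))

          pˢ∣w : ∀ i → pow s ∣ w i
          pˢ∣w i = ∣-· (Q i) pˢ∣z′

          powK∣Au : ∀ i → pow K ∣ (A ∙ u) i
          powK∣Au i = subst₂ _∣_ (sym powK) (sym (Au i))
            (*-monoʳ-∣ (q * q) (∣m∣n⇒∣m+n (pˢ∣w i) (∣n⇒∣m*n (q - 1ℤ) (∣-∑ pˢ∣w))))

          y≡ : ∀ i → (M′ ∙ x) i ≡ x zero * ones i + 1ℤ * u i
          y≡ i = begin
            M′ i · x                                                  ≡⟨ ·-suc (M′ i) x ⟩
            1ℤ * x zero + (λ j → 1ℤ * P⁻¹ i j + (q - 1ℤ) * (Q i j * pow (t ℕ.∸ a j))) · z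
              ≡⟨ cong₂ _+_ (*-comm 1ℤ (x zero)) (·-linearˡ 1ℤ (q - 1ℤ) (P⁻¹ i) (λ j → Q i j * pow (t ℕ.∸ a j)) z) ⟩
            x zero * 1ℤ + (1ℤ * (P⁻¹ i · z) + (q - 1ℤ) * ((λ j → Q i j * pow (t ℕ.∸ a j)) · z))
              ≡⟨ cong (λ v → x zero * 1ℤ + (1ℤ * (P⁻¹ i · z) + (q - 1ℤ) * v)) reassoc ⟩
            x zero * 1ℤ + u i                                         ≡⟨ cong (λ v → x zero * 1ℤ + v) (*-identityˡ (u i)) ⟨
            x zero * 1ℤ + 1ℤ * u i                                    ∎
            where
            reassoc : (λ j → Q i j * pow (t ℕ.∸ a j)) · z ≡ Q i · z′
            reassoc = trans (·-def _ z) (trans (∑-cong (λ j → *-assoc (Q i j) _ (z j))) (sym (·-def (Q i) z′)))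

          Ay : ∀ i → (A ∙ (M′ ∙ x)) i ≡ x zero * (q * q * q * q) + (A ∙ u) i
          Ay i = begin
            A i · (M′ ∙ x)                              ≡⟨ ·-congʳ (A i) y≡ ⟩
            A i · (λ c → x zero * ones c + 1ℤ * u c)    ≡⟨ ·-linear (A i) (x zero) 1ℤ ones u ⟩
            x zero * (A i · ones) + 1ℤ * (A i · u)      ≡⟨ cong₂ (λ b c → x zero * b + c) (A-ones i) (*-identityˡ _) ⟩
            x zero * (q * q * q * q) + A i · u          ∎

          p∣w : ∀ i → + p ∣ w i
          p∣w i = ∣-trans (p∣pow 0<s) (pˢ∣w i)

          -- Modulo p the vector `w` vanishes, so by `∑u` the sum of `u` vanishes too, whereas the
          -- all-ones vector has sum N ≡ 1. The sum therefore isolates `x zero`; what then remains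
          -- of the vector is P⁻¹ z.
          p∣x : (∀ i → + p ∣ (M′ ∙ x) i) → ∀ c → + p ∣ x c
          p∣x p∣y = λ { zero → p∣x₀ ; (suc j) → ∣-P⁻¹ p∣P⁻¹z j }
            where
            ∑y : ∑ (M′ ∙ x) ≡ + N * x zero + (q * q * q + q - 1ℤ) * ∑ w
            ∑y = begin
              ∑ (M′ ∙ x)                                  ≡⟨ ∑-cong y≡ ⟩
              ∑ (λ i → x zero * ones i + 1ℤ * u i)        ≡⟨ ∑-linear (x zero) 1ℤ ones u ⟩
              x zero * ∑ {N} ones + 1ℤ * ∑ u              ≡⟨ cong₂ (λ b c → x zero * b + c) (∑-ones N) (trans (*-identityˡ _) ∑u) ⟩
              x zero * + N + (q * q * q + q - 1ℤ) * ∑ w   ≡⟨ cong (_+ (q * q * q + q - 1ℤ) * ∑ w) (*-comm (x zero) (+ N)) ⟩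
              + N * x zero + (q * q * q + q - 1ℤ) * ∑ w   ∎
            p∣x₀ : + p ∣ x zero
            p∣x₀ = p∣Nx⇒p∣x (∣m+n∣n⇒∣m (subst (+ p ∣_) ∑y (∣-∑ p∣y)) (∣n⇒∣m*n (q * q * q + q - 1ℤ) (∣-∑ p∣w)))
            p∣P⁻¹z : ∀ i → + p ∣ (P⁻¹ ∙ z) i
            p∣P⁻¹z i = subst (+ p ∣_) (*-identityˡ _)
              (∣m+n∣n⇒∣m (subst (+ p ∣_) (*-identityˡ (u i)) (∣m+n∣m⇒∣n (subst (+ p ∣_) (y≡ i) (p∣y i)) (∣m⇒∣m*n 1ℤ p∣x₀)))
                         (∣n⇒∣m*n (q - 1ℤ) (p∣w i)))

      -- If p^k divides Ax and x has sum 0, then p^k divides Bx for B = A + q² - q, and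
      -- q³ P x = P A B x = D Q⁻¹ B x.
      complementary-≥ : N ℕ.≤ below a K ℕ.+ below a k ℕ.+ 1
      complementary-≥ = subst (N ℕ.≤_) total (above-≤ k ws killed⇒p∣)
        where
        -- `ones` removes the J term from the quadratic equation; the rows of `P` with `a j < K`
        -- dispose of the coordinates of P x where `d j` does not supply a factor p^K.
        ws : List (Fin N → ℤ)
        ws = ones ∷ map P (indices (ℕ._<? K) a)
        total : below a k ℕ.+ length ws ≡ below a K ℕ.+ below a k ℕ.+ 1
        total = trans (cong (λ u → below a k ℕ.+ suc u) (trans (List.length-map P (indices (ℕ._<? K) a)) (length-indices (ℕ._<? K) a)))
          (shuffle (below a k) (below a K))
          where
          open import Data.Nat.Tactic.RingSolver using () renaming (solve-∀ to solveℕ)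
          shuffle : ∀ x y → x ℕ.+ suc y ≡ y ℕ.+ x ℕ.+ 1
          shuffle = solveℕ
        killed⇒p∣ : ∀ x → All (Kills x) ws → (∀ i → pow k ∣ (A ∙ x) i) → ∀ i → + p ∣ x i
        killed⇒p∣ x (σ≡0 ∷ killed) pᵏ∣Ax = ∣-P p∣Px
          where
          Bx : Fin N → ℤ
          Bx i = 1ℤ * (A ∙ x) i + (q * q - q) * x i
          pᵏ∣q : pow k ∣ q
          pᵏ∣q = subst (pow k ∣_) (sym q≡pow) (pow-mono-∣ k≤t)
          pᵏ∣Bx : ∀ i → pow k ∣ Bx i
          pᵏ∣Bx i = ∣m∣n⇒∣m+n (∣n⇒∣m*n 1ℤ (pᵏ∣Ax i)) (∣m⇒∣m*n (x i) (∣m∣n⇒∣m-n (∣m⇒∣m*n q pᵏ∣q) pᵏ∣q))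
          ABx : ∀ i → (A ∙ Bx) i ≡ q * q * q * x i
          ABx i = begin
            A i · Bx                                            ≡⟨ ·-linear (A i) 1ℤ (q * q - q) (A ∙ x) x ⟩
            1ℤ * (A i · (A ∙ x)) + (q * q - q) * (A i · x)      ≡⟨ cong (λ v → 1ℤ * v + (q * q - q) * (A i · x)) (AA x i) ⟩
            1ℤ * ((q - q * q) * (A i · x) + q * q * q * (x i + (q - 1ℤ) * ∑ x)) + (q * q - q) * (A i · x)
              ≡⟨ cong (λ σ → 1ℤ * ((q - q * q) * (A i · x) + q * q * q * (x i + (q - 1ℤ) * σ)) + (q * q - q) * (A i · x))
                      (trans (sym (ones-· x)) σ≡0) ⟩
            1ℤ * ((q - q * q) * (A i · x) + q * q * q * (x i + (q - 1ℤ) * 0ℤ)) + (q * q - q) * (A i · x)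
              ≡⟨ tidy q (A i · x) (x i) ⟩
            q * q * q * x i                                     ∎
            where
            tidy : ∀ q a x → 1ℤ * ((q - q * q) * a + q * q * q * (x + (q - 1ℤ) * 0ℤ)) + (q * q - q) * a ≡ q * q * q * x
            tidy = solve-∀
          q³≡pow : q * q * q ≡ pow (t ℕ.+ t ℕ.+ t)
          q³≡pow = trans (cong₂ _*_ q²≡pow q≡pow) (sym (pow-+ (t ℕ.+ t) t))
          q³Px : ∀ j → pow (t ℕ.+ t ℕ.+ t) * (P ∙ x) j ≡ + d j * (Q⁻¹ ∙ Bx) j
          q³Px j = begin
            pow (t ℕ.+ t ℕ.+ t) * (P ∙ x) j     ≡⟨ cong (_* (P ∙ x) j) q³≡pow ⟨
            q * q * q * (P j · x)               ≡⟨ ·-scale (P j) (q * q * q) x ⟨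
            P j · (λ i → q * q * q * x i)       ≡⟨ ·-congʳ (P j) ABx ⟨
            P j · (A ∙ Bx)                      ≡⟨ PA Bx j ⟩
            + d j * (Q⁻¹ ∙ Bx) j                ∎
          K+k : K ℕ.+ k ≡ suc (t ℕ.+ t ℕ.+ t)
          K+k = trans (ℕ.+-assoc (t ℕ.+ t) s k)
            (trans (cong (t ℕ.+ t ℕ.+_) (trans (ℕ.+-comm s k) k+s≡1+t)) (ℕ.+-suc (t ℕ.+ t) t))
          p∣Px : ∀ j → + p ∣ (P ∙ x) j
          p∣Px j with a j ℕ.<? K
          ... | yes aⱼ<K = divides 0ℤ (All-indices (ℕ._<? K) a P killed j aⱼ<K)
          -- `d j` supplies p^K and B x supplies p^k; K + k exceeds 3t by one, so one factor `p` is
          -- left for P x.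
          ... | no  aⱼ≮K = pow-cancel-∣ (ℕ.n<1+n (t ℕ.+ t ℕ.+ t))
            (subst₂ _∣_ (trans (sym (pow-+ K k)) (cong pow K+k)) (sym (q³Px j))
              (∣-trans (*-monoʳ-∣ (pow K) (∣-· (Q⁻¹ j) pᵏ∣Bx))
                       (*-monoˡ-∣ ((Q⁻¹ ∙ Bx) j) (subst (pow K ∣_) (sym (pow-a j)) (pow-mono-∣ (ℕ.≮⇒≥ aⱼ≮K))))))

-- Functions on finite sets

module FiniteFunctions where

  funToFin-cong : ∀ {m n} {f g : Fin m → Fin n} → f ≗ g → funToFin f ≡ funToFin g
  funToFin-cong {zero}  f≗g = ≡.refl
  funToFin-cong {suc m} f≗g = ≡.cong₂ combine (f≗g zero) (funToFin-cong (f≗g ∘ suc))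

  finToFun-injective : ∀ {m n} {v w : Fin (m ^ n)} → finToFun {m} {n} v ≗ finToFun w → v ≡ w
  finToFun-injective {m} {n} {v} {w} eq = ≡.trans (≡.sym (Fin.funToFin-finToFin {n} {m} v))
    (≡.trans (funToFin-cong eq) (Fin.funToFin-finToFin {n} {m} w))

  -- A missed value could be punched out of the codomain, leaving an injection into a smaller set.
  injective⇒surjective : ∀ {n} (f : Fin n → Fin n) → (∀ {i j} → f i ≡ f j → i ≡ j) → ∀ y → ∃[ x ] f x ≡ y
  injective⇒surjective {suc n} f f-injective y with Fin.any? (λ x → f x Fin.≟ y)
  ... | yes hit = hit
  ... | no ¬hit = contradiction
    (Fin.injective⇒≤ {f = λ x → punchOut (miss x)}
      (λ {i} {j} eq → f-injective (Fin.punchOut-injective (miss i) (miss j) eq)))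
    (ℕ.<⇒≱ ℕ.≤-refl)
    where
    miss : ∀ x → y ≢ f x
    miss x y≡fx = ¬hit (x , ≡.sym y≡fx)

-- Finite fields and normalised projective coordinates

module FiniteField {c ℓ ℓ# : Level} (F : HeytingField c ℓ ℓ#) {q : ℕ} (enum : HasOrder F q) where

  open FiniteFunctions
  open CommutativeRing (fieldRing F) hiding (zero)
  open RingProperties ring
  open HeytingField F using (_#_; #⇒invertible; tight)
  open Inverse enum
  open ≈-Reasoning setoid

  infix 4 _≈?_
  _≈?_ : ∀ x y → Dec (x ≈ y)
  x ≈? y = map′ (λ eq → trans (sym (strictlyInverseˡ x)) (trans (to-cong eq) (strictlyInverseˡ y)))
                from-cong (from x Fin.≟ from y)

  to-injective : ∀ {i j} → to i ≈ to j → i ≡ j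
  to-injective {i} {j} eq = ≡.trans (≡.sym (strictlyInverseʳ i)) (≡.trans (from-cong eq) (strictlyInverseʳ j))

  -- Tightness only turns x ≉ 0 into the double negation of x # 0; a search through the finite field
  -- for an inverse is decidable and removes it.
  inverse-of : ∀ {x} → ¬ x ≈ 0# → ∃[ y ] y * x ≈ 1#
  inverse-of {x} x≉0 with Fin.any? (λ i → to i * x ≈? 1#)
  ... | yes (i , eq) = to i , eq
  ... | no ¬∃ = contradiction (proj₁ (tight x 0#) ¬x#0) x≉0
    where
    ¬x#0 : ¬ x # 0#
    ¬x#0 x#0 with #⇒invertible x#0
    ... | y , yx≈1 , _ = ¬∃ (from y , (begin
      to (from y) * x   ≈⟨ *-cong (strictlyInverseˡ y) (sym (trans (+-congˡ -0#≈0#) (+-identityʳ x))) ⟩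
      y * (x - 0#)      ≈⟨ yx≈1 ⟩
      1#                ∎))

  1≉0 : 1 ℕ.< q → ¬ 1# ≈ 0#
  1≉0 1<q 1≈0 = contradiction (Fin.injective⇒≤ {f = λ (_ : Fin q) → zero {0}} (λ {i} {j} _ → all-equal i j)) (ℕ.<⇒≱ 1<q)
    where
    ≈0 : ∀ x → x ≈ 0#
    ≈0 x = trans (sym (*-identityʳ x)) (trans (*-congˡ 1≈0) (zeroʳ x))
    all-equal : ∀ i j → i ≡ j
    all-equal i j = to-injective (trans (≈0 (to i)) (sym (≈0 (to j))))

  vector : ∀ {n} → Fin (q ^ n) → Vector Carrier n
  vector v i = to (finToFun v i)

  code : ∀ {n} → Vector Carrier n → Fin (q ^ n)
  code a = funToFin (from ∘ a)

  vector-code : ∀ {n} (a : Vector Carrier n) i → vector (code a) i ≈ a i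
  vector-code a i = trans (to-cong (Fin.finToFun-funToFin (from ∘ a) i)) (strictlyInverseˡ (a i))

  vector-injective : ∀ {n} {v w : Fin (q ^ n)} → (∀ i → vector {n} v i ≈ vector w i) → v ≡ w
  vector-injective {n} eq = finToFun-injective {q} {n} (λ i → to-injective (eq i))

  -- The number of points of the (n - 1)-dimensional projective space.
  θ : ℕ → ℕ
  θ zero    = 0
  θ (suc n) = q ^ n ℕ.+ θ n

  -- Each point has a unique representative whose first nonzero coordinate is 1.
  mutual
    normalised : ∀ n → Fin (θ n) → Vector Carrier n
    normalised (suc n) r = extend n (splitAt (q ^ n) r)

    extend : ∀ n → Fin (q ^ n) ⊎ Fin (θ n) → Vector Carrier (suc n)
    extend n (inj₁ v) zero    = 1#
    extend n (inj₁ v) (suc i) = vector {n} v i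
    extend n (inj₂ r) zero    = 0#
    extend n (inj₂ r) (suc i) = normalised n r i

  normalise : ∀ {n} (a : Vector Carrier n) {i} → ¬ a i ≈ 0# →
              ∃[ r ] ∃[ x ] (∀ j → a j ≈ x * normalised n r j)
  normalise {suc n} a {i} aᵢ≉0 with a zero ≈? 0#
  ... | no a₀≉0 with inverse-of a₀≉0
  ...   | y , ya₀≈1 = v ↑ˡ θ n , a zero , scaled
    where
    v : Fin (q ^ n)
    v = code (λ j → y * a (suc j))
    scaled : ∀ j → a j ≈ a zero * normalised (suc n) (v ↑ˡ θ n) j
    scaled j rewrite Fin.splitAt-↑ˡ (q ^ n) v (θ n) with j
    ... | zero   = sym (*-identityʳ (a zero))
    ... | suc j′ = begin
      a (suc j′)                       ≈⟨ *-identityˡ _ ⟨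
      1# * a (suc j′)                  ≈⟨ *-congʳ (trans (*-comm (a zero) y) ya₀≈1) ⟨
      a zero * y * a (suc j′)          ≈⟨ *-assoc (a zero) y (a (suc j′)) ⟩
      a zero * (y * a (suc j′))        ≈⟨ *-congˡ (vector-code (λ j → y * a (suc j)) j′) ⟨
      a zero * vector v j′             ∎
  normalise {suc n} a {zero} aᵢ≉0 | yes a₀≈0 = contradiction a₀≈0 aᵢ≉0
  normalise {suc n} a {suc i} aᵢ≉0 | yes a₀≈0 with normalise (a ∘ suc) {i} aᵢ≉0
  ... | r , x , eq = q ^ n ↑ʳ r , x , scaled
    where
    scaled : ∀ j → a j ≈ x * normalised (suc n) (q ^ n ↑ʳ r) j
    scaled j rewrite Fin.splitAt-↑ʳ (q ^ n) (θ n) r with j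
    ... | zero   = trans a₀≈0 (sym (zeroʳ x))
    ... | suc j′ = eq j′

  module _ (1<q : 1 ℕ.< q) where

    normalised-nonzero : ∀ n (r : Fin (θ n)) → ∃[ i ] ¬ normalised n r i ≈ 0#
    normalised-nonzero (suc n) r with splitAt (q ^ n) r
    ... | inj₁ v = zero , 1≉0 1<q
    ... | inj₂ r′ with normalised-nonzero n r′
    ...   | i , nz = suc i , nz

    mutual
      -- The first nonzero coordinates of the two vectors sit at the same place and are both 1,
      -- which forces `x` to be 1.
      normalised-unique : ∀ n (r s : Fin (θ n)) {x} → ¬ x ≈ 0# →
        (∀ i → normalised n s i ≈ x * normalised n r i) → r ≡ s
      normalised-unique (suc n) r s x≉0 eq = ≡.trans (≡.sym (Fin.join-splitAt (q ^ n) (θ n) r))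
        (≡.trans (≡.cong (join (q ^ n) (θ n)) (extend-unique n (splitAt (q ^ n) r) (splitAt (q ^ n) s) x≉0 eq))
          (Fin.join-splitAt (q ^ n) (θ n) s))

      extend-unique : ∀ n (r s : Fin (q ^ n) ⊎ Fin (θ n)) {x} → ¬ x ≈ 0# →
        (∀ i → extend n s i ≈ x * extend n r i) → r ≡ s
      extend-unique n (inj₁ v) (inj₁ w) {x} x≉0 eq = ≡.cong inj₁ (vector-injective {n} (λ i → begin
        vector {n} v i       ≈⟨ *-identityˡ _ ⟨
        1# * vector {n} v i  ≈⟨ *-congʳ (trans (eq zero) (*-identityʳ x)) ⟩
        x * vector {n} v i   ≈⟨ eq (suc i) ⟨
        vector {n} w i       ∎))
      extend-unique n (inj₁ v) (inj₂ s) {x} x≉0 eq = contradiction (trans (sym (*-identityʳ x)) (sym (eq zero))) x≉0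
      extend-unique n (inj₂ r) (inj₁ w) {x} x≉0 eq = contradiction (trans (eq zero) (zeroʳ x)) (1≉0 1<q)
      extend-unique n (inj₂ r) (inj₂ s) x≉0 eq = ≡.cong inj₂ (normalised-unique n r s x≉0 (eq ∘ suc))

-- Linear combinations and projective points over a finite field

module FiniteVectorSpace {c ℓ ℓ# m ℓm : Level} (F : HeytingField c ℓ ℓ#) {q : ℕ} (enum : HasOrder F q)
                         (1<q : 1 ℕ.< q) (V : VectorSpace F m ℓm) where

  open FiniteFunctions
  open FiniteField F enum
  open CommutativeRing (fieldRing F) hiding (zero)
  open RingProperties ring
  open Module V
  module ∑ᴹ = CommutativeMonoidSum +ᴹ-commutativeMonoid
  open ≈-Reasoning ≈ᴹ-setoid

  lc : ∀ {n} → Vector Carrier n → Vector Carrierᴹ n → Carrierᴹ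
  lc = linearCombination F V

  lc-cong : ∀ {n} {a a′ : Vector Carrier n} b → (∀ i → a i ≈ a′ i) → lc a b ≈ᴹ lc a′ b
  lc-cong b a≈a′ = ∑ᴹ.sum-cong-≋ (λ i → *ₗ-congʳ (a≈a′ i))

  lc-zero : ∀ {n} {a : Vector Carrier n} b → (∀ i → a i ≈ 0#) → lc a b ≈ᴹ 0ᴹ
  lc-zero {n} b a≈0 = ≈ᴹ-trans (∑ᴹ.sum-cong-≋ (λ i → ≈ᴹ-trans (*ₗ-congʳ (a≈0 i)) (*ₗ-zeroˡ (b i))))
                              (∑ᴹ.sum-replicate-zero n)

  lc-* : ∀ {n} x (a : Vector Carrier n) b → x *ₗ lc a b ≈ᴹ lc (λ i → x * a i) b
  lc-* {zero}  x a b = *ₗ-zeroʳ x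
  lc-* {suc n} x a b = ≈ᴹ-trans (*ₗ-distribˡ x _ _)
    (+ᴹ-cong (≈ᴹ-sym (*ₗ-assoc x (a zero) (b zero))) (lc-* x (a ∘ suc) (b ∘ suc)))

  lc-+ : ∀ {n} (a a′ : Vector Carrier n) b → lc a b +ᴹ lc a′ b ≈ᴹ lc (λ i → a i + a′ i) b
  lc-+ a a′ b = ≈ᴹ-trans (≈ᴹ-sym (∑ᴹ.∑-distrib-+ (λ i → a i *ₗ b i) (λ i → a′ i *ₗ b i)))
                        (∑ᴹ.sum-cong-≋ (λ i → ≈ᴹ-sym (*ₗ-distribʳ (b i) (a i) (a′ i))))

  cancel : ∀ x v → x *ₗ v +ᴹ (- x) *ₗ v ≈ᴹ 0ᴹ
  cancel x v = ≈ᴹ-trans (≈ᴹ-sym (*ₗ-distribʳ v x (- x))) (≈ᴹ-trans (*ₗ-congʳ (-‿inverseʳ x)) (*ₗ-zeroˡ v))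

  *ₗ-cancel : ∀ {x u v} → ¬ x ≈ 0# → x *ₗ u ≈ᴹ v → ∃[ y ] u ≈ᴹ y *ₗ v
  *ₗ-cancel {x} {u} {v} x≉0 xu≈v with inverse-of x≉0
  ... | y , yx≈1 = y , (begin
    u              ≈⟨ *ₗ-identityˡ u ⟨
    1# *ₗ u        ≈⟨ *ₗ-congʳ yx≈1 ⟨
    (y * x) *ₗ u   ≈⟨ *ₗ-assoc y x u ⟩
    y *ₗ (x *ₗ u)  ≈⟨ *ₗ-congˡ xu≈v ⟩
    y *ₗ v         ∎)

  Independent : ∀ {n} → Vector Carrierᴹ n → Set _
  Independent b = ∀ a → lc a b ≈ᴹ 0ᴹ → ∀ i → a i ≈ 0#

  lc-injective : ∀ {n} (b : Vector Carrierᴹ n) → Independent b →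
                 ∀ a a′ → lc a b ≈ᴹ lc a′ b → ∀ i → a i ≈ a′ i
  lc-injective b independent a a′ eq i =
    x∙y⁻¹≈ε⇒x≈y (a i) (a′ i) (trans (+-congˡ (sym (-1*x≈-x (a′ i)))) (independent _ lc≈0 i))
    where
    lc≈0 : lc (λ i → a i + (- 1#) * a′ i) b ≈ᴹ 0ᴹ
    lc≈0 = begin
      lc (λ i → a i + (- 1#) * a′ i) b    ≈⟨ lc-+ a (λ i → (- 1#) * a′ i) b ⟨
      lc a b +ᴹ lc (λ i → (- 1#) * a′ i) b  ≈⟨ +ᴹ-cong eq (≈ᴹ-sym (lc-* (- 1#) a′ b)) ⟩
      lc a′ b +ᴹ (- 1#) *ₗ lc a′ b          ≈⟨ +ᴹ-congʳ (*ₗ-identityˡ (lc a′ b)) ⟨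
      1# *ₗ lc a′ b +ᴹ (- 1#) *ₗ lc a′ b    ≈⟨ cancel 1# (lc a′ b) ⟩
      0ᴹ                                   ∎

  point : ∀ {n} → Vector Carrierᴹ n → Fin (θ n) → Carrierᴹ
  point {n} b r = lc (normalised n r) b

  module _ {n : ℕ} (b : Vector Carrierᴹ n) (independent : Independent b) where

    point≉0 : ∀ r → ¬ point b r ≈ᴹ 0ᴹ
    point≉0 r eq with normalised-nonzero 1<q n r
    ... | i , aᵢ≉0 = aᵢ≉0 (independent (normalised n r) eq i)

    point-unique : ∀ r s {x} → point b s ≈ᴹ x *ₗ point b r → r ≡ s
    point-unique r s {x} eq = normalised-unique 1<q n r s x≉0
      (lc-injective b independent _ _ (≈ᴹ-trans eq (lc-* x (normalised n r) b)))
      where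
      x≉0 : ¬ x ≈ 0#
      x≉0 x≈0 = point≉0 s (≈ᴹ-trans eq (≈ᴹ-trans (*ₗ-congʳ x≈0) (*ₗ-zeroˡ _)))

  module _ {w : Level} {W : Pred Carrierᴹ w} {n : ℕ} {b : Vector Carrierᴹ n} (basis : IsBasis F V W b) where

    open IsBasis basis

    point-of : ∀ {v} → v ∈ W → ¬ v ≈ᴹ 0ᴹ → ∃[ r ] ∃[ x ] v ≈ᴹ x *ₗ point b r
    point-of v∈W v≉0 with spanning v∈W
    ... | a , v≈ with Fin.any? (λ i → ¬? (a i ≈? 0#))
    ...   | no ¬∃ = contradiction
      (≈ᴹ-trans v≈ (lc-zero b (λ i → decidable-stable (a i ≈? 0#) (λ aᵢ≉0 → ¬∃ (i , aᵢ≉0))))) v≉0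
    ...   | yes (i , aᵢ≉0) with normalise a aᵢ≉0
    ...     | r , x , a≈ = r , x , ≈ᴹ-trans v≈ (≈ᴹ-trans (lc-cong b a≈) (≈ᴹ-sym (lc-* x (normalised n r) b)))

    -- An injective endomorphism of the finite set K^n is surjective.
    exchange : (b′ : Vector Carrierᴹ n) → (∀ a → lc a b′ ∈ W) → Independent b′ →
               ∀ {v} → v ∈ W → ∃[ a ] v ≈ᴹ lc a b′
    exchange b′ b′∈W independent′ {v} v∈W with spanning v∈W
    ... | e , v≈ with injective⇒surjective change change-injective (code e)
      where
      coordinates : ∀ u → ∃[ a ] lc (vector u) b′ ≈ᴹ lc a b
      coordinates u = spanning (b′∈W (vector u))
      -- On codes, the passage from coordinates with respect to `b′` to coordinates with respect to
      -- `b`; a preimage of the code of `e` expresses `v` in terms of `b′`.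
      change : Fin (q ^ n) → Fin (q ^ n)
      change u = code (proj₁ (coordinates u))
      lc-change : ∀ u → lc (vector u) b′ ≈ᴹ lc (vector (change u)) b
      lc-change u = ≈ᴹ-trans (proj₂ (coordinates u)) (lc-cong b (λ i → sym (vector-code _ i)))
      change-injective : ∀ {u u′} → change u ≡ change u′ → u ≡ u′
      change-injective {u} {u′} eq = vector-injective {n} (lc-injective b′ independent′ _ _
        (≈ᴹ-trans (lc-change u) (≈ᴹ-trans (≈ᴹ-reflexive (≡.cong (λ z → lc (vector z) b) eq)) (≈ᴹ-sym (lc-change u′)))))
    ... | u , change≡e = vector u , (begin
      v                                         ≈⟨ v≈ ⟩
      lc e b                                    ≈⟨ lc-cong b (vector-code e) ⟨
      lc (vector (code e)) b                    ≈⟨ ≈ᴹ-reflexive (≡.cong (λ z → lc (vector z) b) change≡e) ⟨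
      lc (vector (code (proj₁ (spanning (b′∈W (vector u)))))) b  ≈⟨ lc-cong b (vector-code _) ⟩
      lc (proj₁ (spanning (b′∈W (vector u)))) b  ≈⟨ proj₂ (spanning (b′∈W (vector u))) ⟨
      lc (vector u) b′                          ∎)

  lc∈ : ∀ {s n} (W : Subspace F V s) (a : Vector Carrier n) b → (∀ i → b i ∈ Subspace.member W) →
        lc a b ∈ Subspace.member W
  lc∈ {n = zero}  W a b b∈W = Subspace.0ᴹ∈ W
  lc∈ {n = suc n} W a b b∈W =
    Subspace.+ᴹ-closed W (Subspace.*ₗ-closed W (a zero) (b∈W zero)) (lc∈ W (a ∘ suc) (b ∘ suc) (b∈W ∘ suc))

-- Counting by sums of indicators

module Indicators where

  open import Data.Integer.Base using (+_; _*_)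
  open import Data.Integer.Properties
  open LinearForms
  open ≡ using (refl; sym; trans; cong; module ≡-Reasoning)

  ⟦_⟧ : ∀ {a} {X : Set a} → Dec X → ℤ
  ⟦ yes _ ⟧ = 1ℤ
  ⟦ no _ ⟧  = 0ℤ

  ⟦⟧-× : ∀ {a b} {X : Set a} {Y : Set b} (x? : Dec X) (y? : Dec Y) → ⟦ x? ⟧ * ⟦ y? ⟧ ≡ ⟦ x? ×-dec y? ⟧
  ⟦⟧-× (yes _) (yes _) = refl
  ⟦⟧-× (yes _) (no _)  = refl
  ⟦⟧-× (no _)  y?      = *-zeroˡ ⟦ y? ⟧

  module _ {ℓ : Level} {n : ℕ} {P : Pred (Fin n) ℓ} (P? : Decidable P) where

    ∑-none : (∀ r → ¬ P r) → ∑ (λ r → ⟦ P? r ⟧) ≡ 0ℤ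
    ∑-none ¬P = ∑-zero _ none
      where
      none : ∀ r → ⟦ P? r ⟧ ≡ 0ℤ
      none r with P? r
      ... | yes Pr = contradiction Pr (¬P r)
      ... | no _   = refl

    ∑-unique : ∀ r → P r → (∀ s → P s → r ≡ s) → ∑ (λ s → ⟦ P? s ⟧) ≡ 1ℤ
    ∑-unique r Pr unique = begin
      ∑ (λ s → ⟦ P? s ⟧)  ≡⟨ ∑-cong indicator ⟩
      ∑ (identity r)       ≡⟨ ·-ones (identity r) ⟨
      identity r · ones    ≡⟨ ·-identity r ones ⟩
      1ℤ                   ∎
      where
      open ≡-Reasoning
      indicator : ∀ s → ⟦ P? s ⟧ ≡ identity r s
      indicator s with P? s | r Fin.≟ s
      ... | yes _  | yes _    = refl
      ... | yes Ps | no r≢s   = contradiction (unique s Ps) r≢s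
      ... | no ¬Ps | yes refl = contradiction Pr ¬Ps
      ... | no _   | no _     = refl

  -- The indicator at `r` is the number of preimages of `r` under `f`, so interchanging the sums
  -- counts the domain.
  ∑-image : ∀ {ℓ n k} {P : Pred (Fin n) ℓ} (P? : Decidable P) (f : Fin k → Fin n) →
            (∀ {c c′} → f c ≡ f c′ → c ≡ c′) → (∀ c → P (f c)) → (∀ r → P r → ∃[ c ] f c ≡ r) →
            ∑ (λ r → ⟦ P? r ⟧) ≡ + k
  ∑-image {k = k} P? f f-injective f∈P surjective = begin
    ∑ (λ r → ⟦ P? r ⟧)                       ≡⟨ ∑-cong fibre ⟩
    ∑ (λ r → ∑ (λ c → ⟦ f c Fin.≟ r ⟧))      ≡⟨ ∑-comm (λ r c → ⟦ f c Fin.≟ r ⟧) ⟩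
    ∑ (λ c → ∑ (λ r → ⟦ f c Fin.≟ r ⟧))      ≡⟨ ∑-cong (λ c → ∑-unique (f c Fin.≟_) (f c) refl (λ _ eq → eq)) ⟩
    ∑ {k} (λ _ → 1ℤ)                         ≡⟨ ∑-const k 1ℤ ⟩
    + k * 1ℤ                                 ≡⟨ *-identityʳ (+ k) ⟩
    + k                                      ∎
    where
    open ≡-Reasoning
    fibre : ∀ r → ⟦ P? r ⟧ ≡ ∑ (λ c → ⟦ f c Fin.≟ r ⟧)
    fibre r with P? r
    ... | no ¬Pr = sym (∑-none (λ c → f c Fin.≟ r) (λ { c refl → ¬Pr (f∈P c) }))
    ... | yes Pr with surjective r Pr
    ...   | c , refl = sym (∑-unique (λ c′ → f c′ Fin.≟ f c) c refl (λ _ eq → f-injective (sym eq)))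

-- Points and lines of the projective 3-space

module ProjectiveSpace {c ℓ ℓ# m ℓm s : Level} (F : HeytingField c ℓ ℓ#) {q : ℕ} (enum : HasOrder F q)
                       (1<q : 1 ℕ.< q) (V : VectorSpace F m ℓm) (ambient : HasDimension F V U 4)
                       {N : ℕ} (order : Ordering F V s 2 N) where

  open FiniteField F enum
  open FiniteVectorSpace F enum 1<q V
  open CommutativeRing (fieldRing F) hiding (zero)
  open Module V
  open LeftModuleProperties leftModule using (inverseʳ-uniqueᴹ)
  open Subspace
  open Indicators
  open Inverse order using () renaming (to to lineOf)
  open IsBasis (proj₂ ambient) using (spanning) renaming (independent to ambient-independent)

  P : Fin (θ 4) → Carrierᴹ
  P = point (proj₁ ambient)

  line : Fin N → Subspace F V s
  line i = proj₁ (lineOf i)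

  line-basis : Fin N → Vector Carrierᴹ 2
  line-basis i = proj₁ (proj₂ (lineOf i))

  line-isBasis : ∀ i → IsBasis F V (member (line i)) (line-basis i)
  line-isBasis i = proj₂ (proj₂ (lineOf i))

  infix 4 _≈ᴹ?_
  _≈ᴹ?_ : ∀ u v → Dec (u ≈ᴹ v)
  u ≈ᴹ? v with spanning {u} _ | spanning {v} _
  ... | a , u≈ | b , v≈ = map′
    (λ a≈b → ≈ᴹ-trans u≈ (≈ᴹ-trans (lc-cong (proj₁ ambient) a≈b) (≈ᴹ-sym v≈)))
    (λ u≈v → lc-injective (proj₁ ambient) ambient-independent a b (≈ᴹ-trans (≈ᴹ-sym u≈) (≈ᴹ-trans u≈v v≈)))
    (Fin.all? (λ i → a i ≈? b i))

  opaque
    -- A search through the `q ^ k` coefficient vectors. Subspaces are arbitrary predicates, and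
    -- this makes membership in a line decidable, as the 0/1 matrix `M` requires.
    span? : ∀ {k} (b : Vector Carrierᴹ k) v → Dec (∃[ a ] v ≈ᴹ lc a b)
    span? b v = map′
      (λ (u , eq) → vector u , eq)
      (λ (a , eq) → code a , ≈ᴹ-trans eq (lc-cong b (λ i → sym (vector-code a i))))
      (Fin.any? (λ u → v ≈ᴹ? lc (vector u) b))

    line? : ∀ i v → Dec (v ∈ member (line i))
    line? i v = map′
      (λ (a , eq) → resp-≈ᴹ (line i) (≈ᴹ-sym eq) (lc∈ (line i) a (line-basis i) (IsBasis.basis∈ (line-isBasis i))))
      (IsBasis.spanning (line-isBasis i))
      (span? (line-basis i) v)

  M : Fin N → Fin (θ 4) → ℤ
  M i r = ⟦ line? i (P r) ⟧

  -- The existential statement lives in a universe fixed by the field and the space, whereas the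
  -- ordered lines are predicates at an arbitrary level `s`. Being decidable, it can be replaced by
  -- its truth value and lifted to `s`.
  InSpan : ∀ {k} → Vector Carrierᴹ k → Pred Carrierᴹ s
  InSpan b v = Lift s (True (span? b v))

  ∈span : ∀ {k} (b : Vector Carrierᴹ k) a {v} → v ≈ᴹ lc a b → InSpan b v
  ∈span b a {v} eq = lift (fromWitness {a? = span? b v} (a , eq))

  coefficients : ∀ {k} (b : Vector Carrierᴹ k) {v} → InSpan b v → ∃[ a ] v ≈ᴹ lc a b
  coefficients b {v} (lift v∈) = toWitness {a? = span? b v} v∈

  span : ∀ {k} → Vector Carrierᴹ k → Subspace F V s
  span b .member = InSpan b
  span b .resp-≈ᴹ u≈v u∈ = let a , eq = coefficients b u∈ in ∈span b a (≈ᴹ-trans (≈ᴹ-sym u≈v) eq)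
  span b .0ᴹ∈ = ∈span b (λ _ → 0#) (≈ᴹ-sym (lc-zero b (λ _ → refl)))
  span b .+ᴹ-closed u∈ v∈ = let a , eq = coefficients b u∈ ; a′ , eq′ = coefficients b v∈ in
    ∈span b (λ i → a i + a′ i) (≈ᴹ-trans (+ᴹ-cong eq eq′) (lc-+ a a′ b))
  span b .*ₗ-closed x u∈ = let a , eq = coefficients b u∈ in
    ∈span b (λ i → x * a i) (≈ᴹ-trans (*ₗ-congˡ eq) (lc-* x a b))

  pair : Carrierᴹ → Carrierᴹ → Vector Carrierᴹ 2
  pair u v zero       = u
  pair u v (suc zero) = v

  ∈-pair : ∀ {w} {W : Pred Carrierᴹ w} {u v} → u ∈ W → v ∈ W → ∀ i → pair u v i ∈ W
  ∈-pair u∈W v∈W zero       = u∈W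
  ∈-pair u∈W v∈W (suc zero) = v∈W

  pair-independent : ∀ {r r′} → r ≢ r′ → Independent (pair (P r) (P r′))
  pair-independent {r} {r′} r≢r′ a eq = λ { zero → a₀≈0 ; (suc zero) → a₁≈0 }
    where
    a₀ a₁ : Carrier
    a₀ = a zero
    a₁ = a (suc zero)
    relation : a₀ *ₗ P r +ᴹ a₁ *ₗ P r′ ≈ᴹ 0ᴹ
    relation = ≈ᴹ-trans (+ᴹ-congˡ (≈ᴹ-sym (+ᴹ-identityʳ _))) eq
    a₁P′≈ : a₁ *ₗ P r′ ≈ᴹ (- a₀) *ₗ P r
    a₁P′≈ = ≈ᴹ-trans (inverseʳ-uniqueᴹ _ _ relation) (≈ᴹ-sym (inverseʳ-uniqueᴹ _ _ (cancel a₀ (P r))))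
    a₁≈0 : a₁ ≈ 0#
    a₁≈0 = decidable-stable (a₁ ≈? 0#) λ a₁≉0 →
      let y , P′≈ = *ₗ-cancel a₁≉0 a₁P′≈
      in r≢r′ (point-unique (proj₁ ambient) ambient-independent r r′ (≈ᴹ-trans P′≈ (≈ᴹ-sym (*ₗ-assoc y (- a₀) (P r)))))
    a₀≈0 : a₀ ≈ 0#
    a₀≈0 = decidable-stable (a₀ ≈? 0#) λ a₀≉0 →
      let a₀P≈0 = ≈ᴹ-trans (≈ᴹ-sym (≈ᴹ-trans (+ᴹ-congˡ (≈ᴹ-trans (*ₗ-congʳ a₁≈0) (*ₗ-zeroˡ _))) (+ᴹ-identityʳ _))) relation
          y , P≈ = *ₗ-cancel a₀≉0 a₀P≈0
      in point≉0 (proj₁ ambient) ambient-independent r (≈ᴹ-trans P≈ (*ₗ-zeroʳ y))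

  joining : ∀ {r r′} → r ≢ r′ → Σ[ W ∈ Subspace F V s ] HasDimension F V (member W) 2
  joining {r} {r′} r≢r′ = span b , b , record
    { basis∈      = λ { zero → ∈span b unit₀ (≈ᴹ-sym lc-unit₀) ; (suc zero) → ∈span b unit₁ (≈ᴹ-sym lc-unit₁) }
    ; independent = pair-independent r≢r′
    ; spanning    = coefficients b
    }
    where
    b = pair (P r) (P r′)
    unit₀ unit₁ : Vector Carrier 2
    unit₀ = λ { zero → 1# ; (suc zero) → 0# }
    unit₁ = λ { zero → 0# ; (suc zero) → 1# }
    lc-unit₀ : lc unit₀ b ≈ᴹ P r
    lc-unit₀ = ≈ᴹ-trans (+ᴹ-cong (*ₗ-identityˡ _) (≈ᴹ-trans (+ᴹ-identityʳ _) (*ₗ-zeroˡ _))) (+ᴹ-identityʳ _)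
    lc-unit₁ : lc unit₁ b ≈ᴹ P r′
    lc-unit₁ = ≈ᴹ-trans (+ᴹ-cong (*ₗ-zeroˡ _) (≈ᴹ-trans (+ᴹ-identityʳ _) (*ₗ-identityˡ _))) (+ᴹ-identityˡ _)

  -- Two distinct points are independent vectors, so by `exchange` they span any line that contains
  -- both.
  two-points-⊆ : ∀ {r r′} → r ≢ r′ → ∀ i (W : Subspace F V s) →
    (∀ j → pair (P r) (P r′) j ∈ member (line i)) → (∀ j → pair (P r) (P r′) j ∈ member W) →
    member (line i) ⊆ member W
  two-points-⊆ {r} {r′} r≢r′ i W ∈line ∈W {v} v∈ = conclude (exchange (line-isBasis i) b (λ a → lc∈ (line i) a b ∈line)
                                                             (pair-independent r≢r′) v∈)
    where
    b = pair (P r) (P r′)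
    conclude : ∃[ a ] v ≈ᴹ lc a b → v ∈ member W
    conclude (a , v≈) = resp-≈ᴹ W (≈ᴹ-sym v≈) (lc∈ W a b ∈W)

  two-points-unique : ∀ {r r′} → r ≢ r′ → ∀ i k →
    P r ∈ member (line i) → P r′ ∈ member (line i) → P r ∈ member (line k) → P r′ ∈ member (line k) → i ≡ k
  two-points-unique {r} {r′} r≢r′ i k r∈i r′∈i r∈k r′∈k =
    ≡.trans (≡.sym (Inverse.strictlyInverseʳ order i))
      (≡.trans (Inverse.from-cong order {lineOf i} {lineOf k}
                 (two-points-⊆ r≢r′ i (line k) ∈i ∈k , two-points-⊆ r≢r′ k (line i) ∈k ∈i))
        (Inverse.strictlyInverseʳ order k))
    where
    ∈i : ∀ j → pair (P r) (P r′) j ∈ member (line i)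
    ∈i = ∈-pair {W = member (line i)} r∈i r′∈i
    ∈k : ∀ j → pair (P r) (P r′) j ∈ member (line k)
    ∈k = ∈-pair {W = member (line k)} r∈k r′∈k

  scalar≉0 : ∀ {u v x} → ¬ v ≈ᴹ 0ᴹ → v ≈ᴹ x *ₗ u → ¬ x ≈ 0#
  scalar≉0 v≉0 v≈xu x≈0 = v≉0 (≈ᴹ-trans v≈xu (≈ᴹ-trans (*ₗ-congʳ x≈0) (*ₗ-zeroˡ _)))

  module OnLine (i : Fin N) where

    b : Vector Carrierᴹ 2
    b = line-basis i

    independent : Independent b
    independent = IsBasis.independent (line-isBasis i)

    representative : ∀ e → ∃[ r ] ∃[ x ] point b e ≈ᴹ x *ₗ P r
    representative e = point-of (proj₂ ambient) _ (point≉0 b independent e)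

    -- A point of the line has two normalised representatives, one in the basis of the line and one
    -- in the ambient basis, differing by a scalar; this passes from the first to the second.
    embed : Fin (θ 2) → Fin (θ 4)
    embed e = proj₁ (representative e)

    embed-≈ : ∀ e → ∃[ y ] P (embed e) ≈ᴹ y *ₗ point b e
    embed-≈ e = let _ , _ , eq = representative e in
      *ₗ-cancel (scalar≉0 (point≉0 b independent e) eq) (≈ᴹ-sym eq)

    point∈ : ∀ e → point b e ∈ member (line i)
    point∈ e = lc∈ (line i) (normalised 2 e) b (IsBasis.basis∈ (line-isBasis i))

    embed∈ : ∀ e → P (embed e) ∈ member (line i)
    embed∈ e = let y , eq = embed-≈ e in
      resp-≈ᴹ (line i) (≈ᴹ-sym eq) (*ₗ-closed (line i) y (point∈ e))

    embed-injective : ∀ {e e′} → embed e ≡ embed e′ → e ≡ e′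
    embed-injective {e} {e′} eq =
      let y , P≈     = embed-≈ e
          _ , x , p≈ = representative e′
      in point-unique b independent e e′
        (≈ᴹ-trans p≈ (≈ᴹ-trans (*ₗ-congˡ (≈ᴹ-trans (≈ᴹ-reflexive (≡.cong P (≡.sym eq))) P≈))
          (≈ᴹ-sym (*ₗ-assoc x y (point b e)))))

    embed-surjective : ∀ r → P r ∈ member (line i) → ∃[ e ] embed e ≡ r
    embed-surjective r r∈i =
      let e , x , P≈ = point-of (line-isBasis i) r∈i (point≉0 (proj₁ ambient) ambient-independent r)
          _ , y , p≈ = representative e
      in e , point-unique (proj₁ ambient) ambient-independent (embed e) r
        (≈ᴹ-trans P≈ (≈ᴹ-trans (*ₗ-congˡ p≈) (≈ᴹ-sym (*ₗ-assoc x y (P (embed e))))))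

  open LinearForms
  open LineSpace using (SkewnessData)
  import Data.Integer.Base as ℤ
  import Data.Integer.Properties as ℤ
  open import Data.Integer.Tactic.RingSolver using () renaming (solve-∀ to solveℤ)
  open import Data.Nat.Tactic.RingSolver using () renaming (solve-∀ to solveℕ)

  ∑M : ∀ i → ∑ (M i) ≡ ℤ.+ θ 2
  ∑M i = ∑-image (λ r → line? i (P r)) embed embed-injective embed∈ embed-surjective
    where open OnLine i

  M·M : ∀ i k → M i · M k ≡ ∑ (λ r → ⟦ line? i (P r) ×-dec line? k (P r) ⟧)
  M·M i k = ≡.trans (·-def (M i) (M k)) (∑-cong (λ r → ⟦⟧-× (line? i (P r)) (line? k (P r))))

  M-idempotent : ∀ i r → M i r ℤ.* M i r ≡ M i r
  M-idempotent i r with line? i (P r)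
  ... | yes _ = ≡.refl
  ... | no _  = ≡.refl

  module _ {A : Matrix N} (isSkew : IsSkewnessMatrix F V order A) where

    no-common-point : ∀ i k → MeetTrivially F V (line i) (line k) →
      ∀ r → ¬ (P r ∈ member (line i) × P r ∈ member (line k))
    no-common-point i k (trivial , _) r r∈ = point≉0 (proj₁ ambient) ambient-independent r (trivial r∈)

    meet-trivially : ∀ i k → (∀ r → ¬ (P r ∈ member (line i) × P r ∈ member (line k))) →
      MeetTrivially F V (line i) (line k)
    meet-trivially i k no-common = ⊆0 , 0⊆
      where
      0⊆ : (_≈ᴹ 0ᴹ) ⊆ member (line i) ∩ member (line k)
      0⊆ v≈0 = resp-≈ᴹ (line i) (≈ᴹ-sym v≈0) (0ᴹ∈ (line i)) , resp-≈ᴹ (line k) (≈ᴹ-sym v≈0) (0ᴹ∈ (line k))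
      ⊆0 : member (line i) ∩ member (line k) ⊆ (_≈ᴹ 0ᴹ)
      ⊆0 {v} (v∈i , v∈k) = decidable-stable (v ≈ᴹ? 0ᴹ) λ v≉0 →
        let r , x , v≈ = point-of (proj₂ ambient) _ v≉0
            y , P≈ = *ₗ-cancel (scalar≉0 v≉0 v≈) (≈ᴹ-sym v≈)
        in no-common r ( resp-≈ᴹ (line i) (≈ᴹ-sym P≈) (*ₗ-closed (line i) y v∈i)
                       , resp-≈ᴹ (line k) (≈ᴹ-sym P≈) (*ₗ-closed (line k) y v∈k))

    q′ : ℤ
    q′ = ℤ.+ q

    θ2≡ : ℤ.+ θ 2 ≡ q′ ℤ.+ 1ℤ
    θ2≡ = ≡.cong ℤ.+_ (lemma q)
      where
      lemma : ∀ q → q ℕ.* 1 ℕ.+ (1 ℕ.+ 0) ≡ q ℕ.+ 1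
      lemma = solveℕ

    -- `M i · M k` counts common points: q + 1 for equal lines, 0 for skew lines, and 1 for distinct
    -- lines that meet.
    skew-entry : ∀ i k → A i k ≡ q′ ℤ.* identity i k ℤ.+ 1ℤ ℤ.- M i · M k
    skew-entry i k with i Fin.≟ k
    ... | yes ≡.refl = ≡.trans A≡0 (≡.trans (evaluate q′) (≡.cong (λ u → q′ ℤ.* 1ℤ ℤ.+ 1ℤ ℤ.- u) (≡.sym M·M≡)))
      where
      M·M≡ : M i · M i ≡ q′ ℤ.+ 1ℤ
      M·M≡ = ≡.trans (·-def (M i) (M i)) (≡.trans (∑-cong (M-idempotent i)) (≡.trans (∑M i) θ2≡))
      evaluate : ∀ q′ → 0ℤ ≡ q′ ℤ.* 1ℤ ℤ.+ 1ℤ ℤ.- (q′ ℤ.+ 1ℤ)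
      evaluate = solveℤ
      A≡0 : A i i ≡ 0ℤ
      A≡0 with proj₁ (isSkew i i)
      ... | inj₁ eq = eq
      ... | inj₂ eq = contradiction (embed∈ e , embed∈ e)
        (no-common-point i i (Equivalence.to (proj₂ (isSkew i i)) eq) (embed e))
        where
        open OnLine i
        e : Fin (θ 2)
        e = q ^ 1 ↑ʳ zero
    ... | no i≢k with proj₁ (isSkew i k)
    ...   | inj₂ A≡1 = ≡.trans A≡1 (≡.trans (evaluate q′) (≡.cong (λ u → q′ ℤ.* 0ℤ ℤ.+ 1ℤ ℤ.- u) (≡.sym M·M≡)))
      where
      M·M≡ : M i · M k ≡ 0ℤ
      M·M≡ = ≡.trans (M·M i k) (∑-none (λ r → line? i (P r) ×-dec line? k (P r))
        (no-common-point i k (Equivalence.to (proj₂ (isSkew i k)) A≡1)))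
      evaluate : ∀ q′ → 1ℤ ≡ q′ ℤ.* 0ℤ ℤ.+ 1ℤ ℤ.- 0ℤ
      evaluate = solveℤ
    ...   | inj₁ A≡0 with Fin.any? (λ r → line? i (P r) ×-dec line? k (P r))
    ...     | no ¬∃ = contradiction
      (≡.trans (≡.sym A≡0) (Equivalence.from (proj₂ (isSkew i k)) (meet-trivially i k (λ r r∈ → ¬∃ (r , r∈))))) λ ()
    ...     | yes (r , r∈i , r∈k) = ≡.trans A≡0 (≡.trans (evaluate q′) (≡.cong (λ u → q′ ℤ.* 0ℤ ℤ.+ 1ℤ ℤ.- u) (≡.sym M·M≡)))
      where
      M·M≡ : M i · M k ≡ 1ℤ
      M·M≡ = ≡.trans (M·M i k) (∑-unique (λ r → line? i (P r) ×-dec line? k (P r)) r (r∈i , r∈k)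
        (λ r′ (r′∈i , r′∈k) → decidable-stable (r Fin.≟ r′)
          (λ r≢r′ → i≢k (two-points-unique r≢r′ i k r∈i r′∈i r∈k r′∈k))))
      evaluate : ∀ q′ → 0ℤ ≡ q′ ℤ.* 0ℤ ℤ.+ 1ℤ ℤ.- 1ℤ
      evaluate = solveℤ

    unique-join : ∀ r r′ → r ≢ r′ → (λ i → M i r) · (λ i → M i r′) ≡ 1ℤ
    unique-join r r′ r≢r′ = ≡.trans (·-def (λ i → M i r) (λ i → M i r′))
      (≡.trans (∑-cong (λ i → ⟦⟧-× (line? i (P r)) (line? i (P r′))))
        (∑-unique (λ i → line? i (P r) ×-dec line? i (P r′)) i (joined zero , joined (suc zero))
          (λ k (r∈k , r′∈k) → two-points-unique r≢r′ i k (joined zero) (joined (suc zero)) r∈k r′∈k)))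
      where
      i : Fin N
      i = Inverse.from order (joining r≢r′)
      joined : ∀ j → pair (P r) (P r′) j ∈ member (line i)
      joined j = proj₂ (Inverse.strictlyInverseˡ order (joining r≢r′))
        (IsBasis.basis∈ (proj₂ (proj₂ (joining r≢r′))) j)

    θ4≡ : ℤ.+ θ 4 ≡ q′ ℤ.* q′ ℤ.* q′ ℤ.+ q′ ℤ.* q′ ℤ.+ q′ ℤ.+ 1ℤ
    θ4≡ = ≡.trans (≡.cong ℤ.+_ (lemma q)) (≡.cong (ℤ._+ 1ℤ) (≡.cong (ℤ._+ q′)
      (≡.cong₂ ℤ._+_ (≡.trans (ℤ.pos-* (q ℕ.* q) q) (≡.cong (ℤ._* q′) (ℤ.pos-* q q))) (ℤ.pos-* q q))))
      where
      lemma : ∀ q → q ℕ.* (q ℕ.* (q ℕ.* 1)) ℕ.+ (q ℕ.* (q ℕ.* 1) ℕ.+ (q ℕ.* 1 ℕ.+ (1 ℕ.+ 0)))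
                    ≡ q ℕ.* q ℕ.* q ℕ.+ q ℕ.* q ℕ.+ q ℕ.+ 1
      lemma = solveℕ

    skewnessData : ∀ {n} → q ≡ suc n → SkewnessData n N (θ 4) A M
    skewnessData q≡ = record
      { points      = ≡.subst (λ q → ℤ.+ θ 4 ≡ q ℤ.* q ℤ.* q ℤ.+ q ℤ.* q ℤ.+ q ℤ.+ 1ℤ) q′≡ θ4≡
      ; skewness    = λ i k → ≡.subst (λ q → A i k ≡ q ℤ.* identity i k ℤ.+ 1ℤ ℤ.- M i · M k) q′≡ (skew-entry i k)
      ; idempotent  = M-idempotent
      ; line-size   = λ i → ≡.trans (∑M i) (≡.subst (λ q → ℤ.+ θ 2 ≡ q ℤ.+ 1ℤ) q′≡ θ2≡)
      ; unique-line = unique-join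
      }
      where
      q′≡ = ≡.cong ℤ.+_ q≡

open import Data.Nat.Base using (_+_; _*_; _∸_; _≤_; _<_; s≤s; z≤n)
open import Data.Nat.Primality using (prime⇒nonTrivial)

-- From cumulative counts to multiplicities

module Arithmetic where

  open ≡

  open import Data.Nat.Tactic.RingSolver using (solve-∀)

  module _ {e L : ℕ → ℕ} (step : ∀ i → e i + L i ≡ L (suc i)) where

    telescope : ∀ n a → ∑ℕ.sum {n = n} (λ k → e (a + Fin.toℕ k)) + L a ≡ L (a + n)
    telescope zero    a = cong L (sym (ℕ.+-identityʳ a))
    telescope (suc n) a = begin
      e (a + 0) + ∑ℕ.sum (λ (k : Fin n) → e (a + suc (Fin.toℕ k))) + L a
        ≡⟨ cong₂ (λ u v → e u + v + L a) (ℕ.+-identityʳ a) (∑ℕ.sum-cong-≗ {n} (λ k → cong e (ℕ.+-suc a (Fin.toℕ k)))) ⟩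
      e a + S + L a      ≡⟨ shuffle (e a) S (L a) ⟩
      S + (e a + L a)    ≡⟨ cong (S +_) (step a) ⟩
      S + L (suc a)      ≡⟨ telescope n (suc a) ⟩
      L (suc a + n)      ≡⟨ cong L (ℕ.+-suc a n) ⟨
      L (a + suc n)      ∎
      where
      open ≡-Reasoning
      S = ∑ℕ.sum (λ (k : Fin n) → e (suc a + Fin.toℕ k))
      shuffle : ∀ x y z → x + y + z ≡ y + (x + z)
      shuffle = solve-∀

    interval-sum : ∀ a b → a ≤ suc b → (∑[ a ⋯ b ] e) + L a ≡ L (suc b)
    interval-sum a b a≤1+b = trans (telescope (suc b ∸ a) a) (cong L (ℕ.m+[n∸m]≡n a≤1+b))

    constant⇒0 : ∀ {i c} → L i ≡ c → L (suc i) ≡ c → e i ≡ 0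
    constant⇒0 {i} {c} Lᵢ≡c L₁₊ᵢ≡c = ℕ.+-cancelʳ-≡ c (e i) 0
      (trans (cong (e i +_) (sym Lᵢ≡c)) (trans (step i) L₁₊ᵢ≡c))

    -- `L` is meant for `below a`, `f` for q³ + q² + q and `g` for q⁴ + q². Then `L` is 0 at 0,
    -- equals `g` on (t, 2t] and f + g on (3t, 4t], and N = f + g + 1 beyond 4t.
    module _ {t N m f g : ℕ} (0<t : 0 < t) (L₀ : L 0 ≡ 0) (mono : ∀ {i j} → i ≤ j → L i ≤ L j)
             (N≡ : N ≡ m + g) (m≡ : m ≡ suc f)
             (N≤L[1+t]+m : N ≤ L (suc t) + m) (L[2t]+m≤N : L (t + t) + m ≤ N) (L[4t]+1≤N : L (t + t + (t + t)) + 1 ≤ N)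
             (complementary : ∀ {k s} → k + s ≡ suc t → 0 < s → L (t + t + s) + L k + 1 ≡ N)
             (L-above : ∀ k → 4 * t < k → L k ≡ N) where

      4t≡ : 4 * t ≡ t + t + (t + t)
      4t≡ = lemma t
        where
        lemma : ∀ t → 4 * t ≡ t + t + (t + t)
        lemma = solve-∀

      2t≡ : 2 * t ≡ t + t
      2t≡ = cong (t +_) (ℕ.+-identityʳ t)

      3t≡ : 3 * t ≡ t + t + t
      3t≡ = lemma t
        where
        lemma : ∀ t → 3 * t ≡ t + t + t
        lemma = solve-∀

      -- Squeezed by monotonicity: g ≤ L (t + 1) ≤ L k ≤ L (2t) ≤ g.
      L-middle : ∀ {k} → t < k → k ≤ 2 * t → L k ≡ g
      L-middle {k} t<k k≤2t = ℕ.≤-antisym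
        (ℕ.≤-trans (mono k≤2t) (ℕ.+-cancelʳ-≤ m _ _ (subst₂ (λ u v → L u + m ≤ v) (sym 2t≡) (trans N≡ (ℕ.+-comm m g)) L[2t]+m≤N)))
        (ℕ.≤-trans (ℕ.+-cancelʳ-≤ m _ _ (subst (_≤ L (suc t) + m) (trans N≡ (ℕ.+-comm m g)) N≤L[1+t]+m)) (mono t<k))

      -- The complement identity at `k = 0`: no exponent is less than 0, so exactly one exceeds 3t.
      L[1+3t] : L (suc (3 * t)) + 1 ≡ N
      L[1+3t] = trans (cong (_+ 1) (trans (sym (ℕ.+-identityʳ _)) (cong₂ _+_ (cong L eq) (sym L₀)))) (complementary {0} refl (s≤s z≤n))
        where
        eq : suc (3 * t) ≡ t + t + suc t
        eq = trans (cong suc 3t≡) (sym (ℕ.+-suc (t + t) t))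

      L-upper : ∀ {k} → 3 * t < k → k ≤ 4 * t → L k + 1 ≡ N
      L-upper {k} 3t<k k≤4t = ℕ.≤-antisym
        (ℕ.≤-trans (ℕ.+-monoˡ-≤ 1 (mono k≤4t)) (subst (λ u → L u + 1 ≤ N) (sym 4t≡) L[4t]+1≤N))
        (subst (_≤ L k + 1) L[1+3t] (ℕ.+-monoˡ-≤ 1 (mono 3t<k)))

      L-upper′ : ∀ {k} → 3 * t < k → k ≤ 4 * t → L k ≡ f + g
      L-upper′ {k} 3t<k k≤4t = ℕ.+-cancelʳ-≡ 1 _ _
        (trans (L-upper 3t<k k≤4t) (trans N≡ (trans (cong (_+ g) m≡) (ℕ.+-comm 1 (f + g)))))

      3t<4t : 3 * t < 4 * t
      3t<4t = ℕ.m<n+m (3 * t) 0<t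

      -- The complement identities at `k = i` and `k = suc i` have the same right-hand side, so the
      -- increments of `L` at `i` and at 3t - i agree. The second identity needs `0 < t ∸ i`, hence
      -- `i < t`.
      symmetry : ∀ i → i < t → e i ≡ e (3 * t ∸ i)
      symmetry i i<t = sym (ℕ.+-cancelʳ-≡ (L j + L i) _ _ (begin
        e (3 * t ∸ i) + (L j + L i)      ≡⟨ cong (λ u → e u + (L j + L i)) 3t∸i≡j ⟩
        e j + (L j + L i)                ≡⟨ ℕ.+-assoc (e j) (L j) (L i) ⟨
        e j + L j + L i                  ≡⟨ cong (_+ L i) (trans (step j) (cong L (sym (ℕ.+-suc (t + t) (t ∸ i))))) ⟩
        L (t + t + suc (t ∸ i)) + L i    ≡⟨ ℕ.+-cancelʳ-≡ 1 _ _ (trans (complementary i+ (s≤s z≤n)) (sym (complementary (cong suc (ℕ.m+[n∸m]≡n (ℕ.<⇒≤ i<t))) (ℕ.m<n⇒0<n∸m i<t)))) ⟩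
        L j + L (suc i)                  ≡⟨ cong (L j +_) (step i) ⟨
        L j + (e i + L i)                ≡⟨ shuffle (L j) (e i) (L i) ⟩
        e i + (L j + L i)                ∎))
        where
        open ≡-Reasoning
        j = t + t + (t ∸ i)
        3t∸i≡j : 3 * t ∸ i ≡ j
        3t∸i≡j = trans (cong (_∸ i) 3t≡) (ℕ.+-∸-assoc (t + t) (ℕ.<⇒≤ i<t))
        i+ : i + suc (t ∸ i) ≡ suc t
        i+ = trans (ℕ.+-suc i (t ∸ i)) (cong suc (ℕ.m+[n∸m]≡n (ℕ.<⇒≤ i<t)))
        shuffle : ∀ x y z → x + (y + z) ≡ y + (x + z)
        shuffle = solve-∀

      conclusion :
        (∀ i → i < t → e i ≡ e (3 * t ∸ i)) ×
        ((∀ i → t < i → i < 2 * t → e i ≡ 0) ×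
         (∀ i → 3 * t < i → i < 4 * t → e i ≡ 0) ×
         (∀ i → 4 * t < i → e i ≡ 0)) ×
        (∑[ 0 ⋯ t ] e) ≡ g ×
        (∑[ 2 * t ⋯ 3 * t ] e) ≡ f ×
        e (4 * t) ≡ 1
      conclusion =
        symmetry ,
        ((λ i t<i i<2t → constant⇒0 (L-middle t<i (ℕ.<⇒≤ i<2t)) (L-middle (ℕ.m<n⇒m<1+n t<i) i<2t)) ,
         (λ i 3t<i i<4t → constant⇒0 (L-upper′ 3t<i (ℕ.<⇒≤ i<4t)) (L-upper′ (ℕ.m<n⇒m<1+n 3t<i) i<4t)) ,
         (λ i 4t<i → constant⇒0 (L-above i 4t<i) (L-above (suc i) (ℕ.m<n⇒m<1+n 4t<i)))) ,
        trans (sym (ℕ.+-identityʳ _)) (trans (cong ((∑[ 0 ⋯ t ] e) +_) (sym L₀))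
          (trans (interval-sum 0 t z≤n) (L-middle ℕ.≤-refl t<2t))) ,
        ℕ.+-cancelʳ-≡ g _ _ (trans (cong ((∑[ 2 * t ⋯ 3 * t ] e) +_) (sym (L-middle t<2t ℕ.≤-refl)))
          (trans (interval-sum (2 * t) (3 * t) (ℕ.m≤n⇒m≤1+n (ℕ.m≤n+m (2 * t) t))) (L-upper′ ℕ.≤-refl 3t<4t))) ,
        ℕ.+-cancelʳ-≡ (f + g) _ _ (trans (cong (e (4 * t) +_) (sym (L-upper′ 3t<4t ℕ.≤-refl)))
          (trans (step (4 * t)) (trans (L-above (suc (4 * t)) ℕ.≤-refl) (trans N≡ (cong (_+ g) m≡)))))
        where
        t<2t : t < 2 * t
        t<2t = subst (t <_) (sym 2t≡) (ℕ.m<m+n t 0<t)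

-- Comparing powers of p with their exponents

module Multiplicities where

  open ≡

  count-cong : ∀ {n} {P Q : Pred ℕ 0ℓ} (P? : Decidable P) (Q? : Decidable Q) (f g : Fin n → ℕ) →
    (∀ j → P (f j) → Q (g j)) → (∀ j → Q (g j) → P (f j)) → count P? (tabulate f) ≡ count Q? (tabulate g)
  count-cong {zero}  P? Q? f g P⇒Q Q⇒P = refl
  count-cong {suc n} P? Q? f g P⇒Q Q⇒P
    with P? (f zero) | Q? (g zero) | count-cong P? Q? (f ∘ suc) (g ∘ suc) (P⇒Q ∘ suc) (Q⇒P ∘ suc)
  ... | yes _ | yes _  | ih = cong suc ih
  ... | yes p | no ¬q  | _  = contradiction (P⇒Q zero p) ¬q
  ... | no ¬p | yes q  | _  = contradiction (Q⇒P zero q) ¬p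
  ... | no _  | no _   | ih = ih

  ^-injectiveʳ : ∀ {p i j} → 1 < p → p ^ i ≡ p ^ j → i ≡ j
  ^-injectiveʳ {p} {i} {j} 1<p eq with ℕ.<-cmp i j
  ... | tri≈ _ i≡j _ = i≡j
  ... | tri< i<j _ _ = contradiction eq (ℕ.<⇒≢ (ℕ.^-monoʳ-< p 1<p i<j))
  ... | tri> _ _ j<i = contradiction (sym eq) (ℕ.<⇒≢ (ℕ.^-monoʳ-< p 1<p j<i))

-- Multiplicities for the skewness matrix

module SkewLines where

  open ≡

  open LinearForms using (∑)
  open Counting
  open LineSpace
  open Multiplicities
  import Data.Integer.Base as ℤ
  import Data.Integer.Properties as ℤ
  open import Data.Integer.Tactic.RingSolver using () renaming (solve-∀ to solveℤ)
  open import Data.Nat.Tactic.RingSolver using (solve-∀)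

  module _ {n N m : ℕ} {A : Matrix N} {M : Fin N → Fin m → ℤ.ℤ} (G : SkewnessData n N m A M) where

    q : ℕ
    q = suc n

    m≡ : m ≡ suc (q ^ 3 + q ^ 2 + q)
    m≡ = ℤ.+-injective (trans (SkewnessData.points G) (cast q))
      where
      cast : ∀ q → ℤ.+ q ℤ.* ℤ.+ q ℤ.* ℤ.+ q ℤ.+ ℤ.+ q ℤ.* ℤ.+ q ℤ.+ ℤ.+ q ℤ.+ ℤ.1ℤ ≡ ℤ.+ suc (q ^ 3 + q ^ 2 + q)
      cast q rewrite sym (ℤ.pos-* q q) | sym (ℤ.pos-* (q * q) q) = cong ℤ.+_ (lemma q)
        where
        lemma : ∀ q → q * q * q + q * q + q + 1 ≡ suc (q * (q * (q * 1)) + q * (q * 1) + q)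
        lemma = solve-∀

    N≡ : N ≡ m + (q ^ 4 + q ^ 2)
    N≡ = ℤ.+-injective (trans (Identities.lines G) (trans (expand (ℤ.+ q))
      (trans (cong₂ ℤ._+_ (sym (SkewnessData.points G)) (cast q)) (sym (ℤ.pos-+ m (q ^ 4 + q ^ 2))))))
      where
      expand : ∀ q → (q ℤ.* q ℤ.+ ℤ.1ℤ) ℤ.* (q ℤ.* q ℤ.+ q ℤ.+ ℤ.1ℤ)
                     ≡ (q ℤ.* q ℤ.* q ℤ.+ q ℤ.* q ℤ.+ q ℤ.+ ℤ.1ℤ) ℤ.+ (q ℤ.* q ℤ.* q ℤ.* q ℤ.+ q ℤ.* q)
      expand = solveℤ
      cast : ∀ q → ℤ.+ q ℤ.* ℤ.+ q ℤ.* ℤ.+ q ℤ.* ℤ.+ q ℤ.+ ℤ.+ q ℤ.* ℤ.+ q ≡ ℤ.+ (q ^ 4 + q ^ 2)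
      cast q rewrite sym (ℤ.pos-* q q) | sym (ℤ.pos-* (q * q) q) | sym (ℤ.pos-* (q * q * q) q) = cong ℤ.+_ (lemma q)
        where
        lemma : ∀ q → q * q * q * q + q * q ≡ q * (q * (q * (q * 1))) + q * (q * 1)
        lemma = solve-∀

    module _ (snf : SmithNormalForm A) {p t : ℕ} (pr : Prime p) (0<t : 0 < t) (pᵗ≡q : p ^ t ≡ q) where

      1<p : 1 < p
      1<p = ℕ.nonTrivial⇒n>1 p {{prime⇒nonTrivial pr}}

      a : Fin N → ℕ
      a j = proj₁ (Exponents.exponent G snf p t pr pᵗ≡q j)

      a≤4t : ∀ j → a j ≤ 4 * t
      a≤4t j = proj₁ (proj₂ (Exponents.exponent G snf p t pr pᵗ≡q j))

      d≡pᵃ : ∀ j → SmithNormalForm.d snf j ≡ p ^ a j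
      d≡pᵃ j = proj₂ (proj₂ (Exponents.exponent G snf p t pr pᵗ≡q j))

      e : ℕ → ℕ
      e i = SmithNormalForm.multiplicity snf (p ^ i)

      step : ∀ i → e i + below a i ≡ below a (suc i)
      step i = trans (cong (_+ below a i) (count-cong (ℕ._≟ p ^ i) (ℕ._≟ i) (SmithNormalForm.d snf) a
        (λ j d≡ → ^-injectiveʳ 1<p (trans (sym (d≡pᵃ j)) d≡)) (λ j a≡ → trans (d≡pᵃ j) (cong (p ^_) a≡))))
        (below-suc a i)

      open Exponents.Claims G snf 1<p 0<t pᵗ≡q a d≡pᵃ

      multiplicities :
        (∀ i → i < t → e i ≡ e (3 * t ∸ i)) ×
        ((∀ i → t < i → i < 2 * t → e i ≡ 0) ×
         (∀ i → 3 * t < i → i < 4 * t → e i ≡ 0) ×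
         (∀ i → 4 * t < i → e i ≡ 0)) ×
        (∑[ 0 ⋯ t ] e) ≡ q ^ 4 + q ^ 2 ×
        (∑[ 2 * t ⋯ 3 * t ] e) ≡ q ^ 3 + q ^ 2 + q ×
        e (4 * t) ≡ 1
      multiplicities = Arithmetic.conclusion step 0<t below-0 (below-mono-≤ a) N≡ m≡ N≤below[1+t]+m below[2t]+m≤N below[4t]+1≤N
        (λ k+s 0<s → ℕ.≤-antisym (complementary-≤ k+s 0<s) (complementary-≥ k+s 0<s))
        (λ k 4t<k → below-all a k (λ j → ℕ.≤-<-trans (a≤4t j) 4t<k))
        where
        below-0 : below a 0 ≡ 0
        below-0 = count-none a
          where
          count-none : ∀ {k} (a : Fin k → ℕ) → below a 0 ≡ 0
          count-none {zero}  a = refl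
          count-none {suc k} a = count-none (a ∘ suc)

theorem1 :
    ∀ {c ℓ ℓ# m ℓm s : Level} (p t : ℕ) → Prime p → 1 ≤ t →
    (F : HeytingField c ℓ ℓ#) → HasOrder F (p ^ t) →
    (V : VectorSpace F m ℓm) → HasDimension F V U 4 →
    {N : ℕ} (order : Ordering F V s 2 N) →
    (A : Matrix N) → IsSkewnessMatrix F V order A →
    (snf : SmithNormalForm A) →
    let q = p ^ t
        e = λ i → SmithNormalForm.multiplicity snf (p ^ i)
    in
      (∀ i → i < t → e i ≡ e (3 * t ∸ i)) ×
      ((∀ i → t < i → i < 2 * t → e i ≡ 0) ×
       (∀ i → 3 * t < i → i < 4 * t → e i ≡ 0) ×
       (∀ i → 4 * t < i → e i ≡ 0)) ×
      (∑[ 0 ⋯ t ] e) ≡ q ^ 4 + q ^ 2 ×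
      (∑[ 2 * t ⋯ 3 * t ] e) ≡ q ^ 3 + q ^ 2 + q ×
      e (4 * t) ≡ 1
theorem1 p t pr 1≤t F enum V ambient {N} order A isSkew snf =
  conclude (ℕ.pred (p ^ t)) (≡.sym (ℕ.suc-pred (p ^ t) {{ℕ.>-nonZero (ℕ.<-trans (s≤s z≤n) 1<q)}}))
  where
  1<q : 1 < p ^ t
  1<q = ℕ.^-monoʳ-< p (ℕ.nonTrivial⇒n>1 p {{prime⇒nonTrivial pr}}) 1≤t
  e : ℕ → ℕ
  e i = SmithNormalForm.multiplicity snf (p ^ i)
  -- The incidence data take the order in the form `suc n`; the result is transported back to
  -- `p ^ t`.
  conclude : ∀ n → p ^ t ≡ suc n → _
  conclude n q≡ = ≡.subst
    (λ q → (∀ i → i < t → e i ≡ e (3 * t ∸ i)) ×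
      ((∀ i → t < i → i < 2 * t → e i ≡ 0) ×
       (∀ i → 3 * t < i → i < 4 * t → e i ≡ 0) ×
       (∀ i → 4 * t < i → e i ≡ 0)) ×
      (∑[ 0 ⋯ t ] e) ≡ q ^ 4 + q ^ 2 ×
      (∑[ 2 * t ⋯ 3 * t ] e) ≡ q ^ 3 + q ^ 2 + q ×
      e (4 * t) ≡ 1)
    (≡.sym q≡)
    (SkewLines.multiplicities (ProjectiveSpace.skewnessData F enum 1<q V ambient order isSkew q≡) snf pr 1≤t q≡)
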